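{- Let $T=\{1243,2413,3142\}$ and let $F_T(x)=\sum_{n\ge0}|S_n(T)|x^n$. Then, as formal power series, $$F_T(x)=\frac{1-x(1-x)C(x)-\sqrt{1-5x+10x^2-5x^3-x(1-x)(1+x)C(x)}}{2x(1-x)},$$ where $C(x)=\frac{1-\sqrt{1-4x}}{2x}$.
   Context: $S_n$ is the set of permutations of $[n]$ ($S_0$ contains the empty permutation). A permutation avoids a pattern $\tau$ if it has no subsequence order-isomorphic to $\tau$; $S_n(T)$ is the set of permutations in $S_n$ avoiding every pattern in $T$. $C(x)$ is the Catalan generating function. -}

module Defs where

open import Data.Nat as ℕ using (ℕ; zero; suc; _∸_)
open import Data.Nat.Combinatorics using (_C_)
open import Data.Integer as ℤ using (ℤ; +_; -[1+_])
open import Data.Fin using (Fin; toℕ)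
open import Data.Vec using (Vec; lookup)
open import Data.List using (List; []; _∷_; map; upTo; sum; foldr; length)
open import Data.List.Membership.Propositional using (_∈_)
open import Data.List.Relation.Unary.Unique.Propositional using (Unique)
open import Data.List.Relation.Unary.All using (All)
open import Data.Product using (Σ; _×_; ∃)
open import Relation.Nullary using (¬_)
open import Relation.Binary.PropositionalEquality using (_≡_)
open import Function.Bundles using (_⇔_)

IsPerm : (n : ℕ) → Vec (Fin n) n → Set
IsPerm n v = ∀ i j → lookup v i ≡ lookup v j → i ≡ j

-- A pattern of length k is given in one-line notation by a vector of
-- naturals (e.g. 1243 = 1 ∷ 2 ∷ 4 ∷ 3 ∷ []).
-- σ contains τ: there are positions f 0 < f 1 < ... < f (k-1) such that
-- σ(f 0) ... σ(f (k-1)) is order-isomorphic to τ.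
Contains : {n k : ℕ} → Vec (Fin n) n → Vec ℕ k → Set
Contains {n} {k} σ τ =
  Σ (Fin k → Fin n) λ f →
    (∀ i j → toℕ i ℕ.< toℕ j → toℕ (f i) ℕ.< toℕ (f j)) ×
    (∀ i j → (lookup τ i ℕ.< lookup τ j) ⇔ (toℕ (lookup σ (f i)) ℕ.< toℕ (lookup σ (f j))))

Avoids : {n k : ℕ} → Vec (Fin n) n → Vec ℕ k → Set
Avoids σ τ = ¬ Contains σ τ

AvoidsAll : {n k : ℕ} → Vec (Fin n) n → List (Vec ℕ k) → Set
AvoidsAll σ T = All (Avoids σ) T

CardAv : {k : ℕ} → List (Vec ℕ k) → (n m : ℕ) → Set
CardAv T n m =
  Σ (List (Vec (Fin n) n)) λ L →
    Unique L × length L ≡ m × (∀ σ → (σ ∈ L) ⇔ (IsPerm n σ × AvoidsAll σ T))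

T : List (Vec ℕ 4)
T = (1 ∷ 2 ∷ 4 ∷ 3 ∷ Data.Vec.[]) ∷ (2 ∷ 4 ∷ 1 ∷ 3 ∷ Data.Vec.[]) ∷ (3 ∷ 1 ∷ 4 ∷ 2 ∷ Data.Vec.[]) ∷ []
  where open Data.Vec using (_∷_)

PS : Set
PS = ℕ → ℤ

infix 4 _≈_
_≈_ : PS → PS → Set
f ≈ g = ∀ n → f n ≡ g n

infixl 6 _⊕_ _⊖_
infixl 7 _⊛_

_⊕_ : PS → PS → PS
(f ⊕ g) n = f n ℤ.+ g n

_⊖_ : PS → PS → PS
(f ⊖ g) n = f n ℤ.- g n

_⊛_ : PS → PS → PS
(f ⊛ g) n = foldr ℤ._+_ (+ 0) (map (λ i → f i ℤ.* g (n ∸ i)) (upTo (suc n)))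

poly : List ℤ → PS
poly []       n       = + 0
poly (c ∷ cs) zero    = c
poly (c ∷ cs) (suc n) = poly cs n

X : PS
X = poly (+ 0 ∷ + 1 ∷ [])

catalan : ℕ → ℕ
catalan n = ((2 ℕ.* n) C n) ℕ./ suc n

Cat : PS
Cat n = + catalan n

gf : (ℕ → ℕ) → PS
gf a n = + a n

{-# OPTIONS --safe #-}
-- Avoiders of 2413 and 3142 decompose into direct sums and skew sums.  Let M be
-- the maximum of a nonempty avoider w = u M v.  If u > v, then w is the
-- skew sum of u M and v.  Otherwise the first letter ℓ of w is exceeded by a letter
-- of v, and comparing all letters with ℓ cuts w as d e M f g with g < d < e M f,
-- where d is decreasing, e M f avoids 132 and f is nonempty.  The first factor of
-- this skew decomposition is skew-indecomposable, so it is read off w, and with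
-- C = 1 + xC² for the 132-avoiders one gets
--   F = 1 + x(F + x/(1−x) · C(C − 1))F,  that is,  F = (1 − x)(1 + xCF + xF²).
-- Completing the square gives the formula.
--
-- Permutations of an interval {b, …, b + n − 1} are plain words, so that both kinds
-- of sums are concatenations.  C = 1 + xC² is obtained from the closed form of the
-- Catalan numbers: y = 1 − 2xC satisfies (1 − 4x) θy = −2xy with θ = x·d/dx, and
-- therefore (1 − 4x) θ(y²) = −4xy², which forces y² = 1 − 4x.
module Submission where

-- Why the case u ≯ v is so rigid: fix a letter r of v with r > ℓ. The pair M r is then the end 43
-- of a 1243, or the end 42 of a 3142, for suitable letters before it. This makes d decreasing and
-- keeps the letters of u above ℓ behind those below it. The letter ℓ itself is the 1 of a 1243 for
-- every 132 among the larger letters. The condition that f is nonempty keeps this case apart from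
-- the words that end in their maximum. It turns one factor C into C - 1. The two forms of the
-- equation for F agree as follows. Multiplication by 1 - x removes 1/(1 - x) and leaves F = xF + (1
-- - x)(1 + xF²) + x²C(C - 1)F. The Catalan equation then merges xF + x²C²F into xCF. The square
-- root is a series with prescribed square and constant term 1; no root of a series is ever
-- extracted.

open import Defs
open import Data.Nat using (ℕ)
open import Data.Integer using (+_; -[1+_])
open import Data.List using ([]; _∷_)
open import Data.Product using (Σ; _×_)
open import Relation.Binary.PropositionalEquality using (_≡_)

open import Algebra.Bundles using (CommutativeRing)
import Algebra.Solver.Ring
open import Algebra.Solver.Ring.AlmostCommutativeRing using (_-Raw-AlmostCommutative⟶_; fromCommutativeRing)
open import Data.Empty using (⊥; ⊥-elim)
open import Data.Fin.Base using (Fin; zero; suc; toℕ; fromℕ<)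
open import Data.Fin.Patterns using (0F; 1F; 2F; 3F)
import Data.Fin.Properties as Fin
open import Data.Integer.Base as ℤ using (ℤ)
import Data.Integer.Properties as ℤ
import Data.Integer.Tactic.RingSolver as ℤSolver
open import Data.List.Base as List using (List; _++_; applyUpTo; cartesianProduct; foldr; initLast; length; map; tabulate; upTo; _∷ʳ′_)
open import Data.List.Membership.Propositional using (_∈_; _∉_; find; lose)
open import Data.List.Membership.Propositional.Properties using (∈-++⁺ˡ; ∈-++⁺ʳ; ∈-++⁻; ∈-applyUpTo⁺; ∈-applyUpTo⁻; ∈-cartesianProduct⁺; ∈-cartesianProduct⁻; ∈-lookup; ∈-map⁺; ∈-map⁻; ∈-tabulate⁺; ∈-tabulate⁻; ∈-upTo⁺; ∈-upTo⁻; ∈-∃++)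
open import Data.List.Membership.Propositional.Properties.WithK using (unique∧set⇒bag)
open import Data.List.Properties using (++-assoc; ++-cancelˡ; ++-identityʳ; length-++; length-applyUpTo; length-map; map-applyUpTo; map-upTo; tabulate-cong; tabulate-lookup; ∷-injectiveʳ; ∷-injectiveˡ; ∷ʳ-injectiveˡ)
open import Data.List.Relation.Binary.BagAndSetEquality using (∼bag⇒↭)
open import Data.List.Relation.Binary.Permutation.Propositional.Properties using (↭-length)
open import Data.List.Relation.Binary.Sublist.Propositional using (_⊆_; []; _∷_; _∷ʳ_; ⊆-refl; ⊆-trans; ⊆-reflexive; minimum; from∈; to∈; lookup)
open import Data.List.Relation.Binary.Sublist.Propositional.Properties using (++⁺; ++⁺ˡ; ++⁺ʳ; ∷ˡ⁻)
open import Data.List.Relation.Unary.All as All using ([]; _∷_)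
import Data.List.Relation.Unary.All.Properties as All
open import Data.List.Relation.Unary.AllPairs using ([]; _∷_)
open import Data.List.Relation.Unary.Any using (any?; here; there)
open import Data.List.Relation.Unary.Unique.Propositional using (Unique)
import Data.List.Relation.Unary.Unique.Propositional.Properties as Unique
open import Data.Maybe.Base as Maybe using (Maybe)
open import Data.Nat.Base as ℕ using (zero; suc; _+_; _∸_; _!; _≤_; _<_; z≤n; s≤s; s<s; NonZero)
open import Data.Nat.Combinatorics using (nCk≡n!/k![n-k]!; k![n∸k]!∣n!) renaming (_C_ to _choose_)
open import Data.Nat.DivMod using (m/n*n≡m)
open import Data.Nat.Divisibility using (_∣_; divides-refl; ∣m+n∣m⇒∣n; m∣m*n)
open import Data.Nat.Induction using (<-rec)
open import Data.Nat.ListAction using (sum)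
import Data.Nat.Properties as ℕ
import Data.Nat.Tactic.RingSolver as ℕSolver
open import Data.Product.Base using (_,_; ∃; ∃₂; proj₁; proj₂)
open import Data.Sum.Base using (_⊎_; inj₁; inj₂; [_,_]′)
open import Data.Vec.Base as Vec using (Vec)
import Data.Vec.Properties as Vec
open import Function.Base using (_∘_; id)
open import Function.Bundles using (_⇔_; mk⇔; Equivalence)
open import Level using (0ℓ)
open import Relation.Binary.Consequences using (dec⇒weaklyDec)
open import Relation.Binary.Definitions using (tri<; tri≈; tri>)
open import Relation.Binary.PropositionalEquality using (_≢_; refl; sym; trans; cong; cong₂; subst; subst₂; module ≡-Reasoning)
import Relation.Binary.Reasoning.Setoid
open import Relation.Nullary using (¬_; Dec; yes; no)
open import Relation.Nullary.Decidable using (True; toWitness; _×-dec_)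

-- Formal power series

tl : PS → PS
tl f n = f (suc n)

-- The recursion behind the ring laws: peeling off the first coefficient of the left factor leaves a
-- product with its tail at a smaller degree, so induction on the degree works with `f` generalised.
⊛-suc : ∀ f g n → (f ⊛ g) (suc n) ≡ f 0 ℤ.* g (suc n) ℤ.+ (tl f ⊛ g) n
⊛-suc f g n = cong (λ xs → f 0 ℤ.* g (suc n) ℤ.+ foldr ℤ._+_ (+ 0) xs)
  (trans (map-applyUpTo suc (λ i → f i ℤ.* g (suc n ∸ i)) (suc n))
         (sym (map-upTo (λ i → f (suc i) ℤ.* g (n ∸ i)) (suc n))))

⊛-zero : ∀ f g → (f ⊛ g) 0 ≡ f 0 ℤ.* g 0
⊛-zero f g = ℤ.+-identityʳ _

0PS 1PS : PS
0PS n = + 0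
1PS = poly (+ 1 ∷ [])

⊝_ : PS → PS
(⊝ f) n = ℤ.- f n

⊛-cong : ∀ {f f' g g'} → f ≈ f' → g ≈ g' → f ⊛ g ≈ f' ⊛ g'
⊛-cong {f} {f'} {g} {g'} p q zero = trans (⊛-zero f g) (trans (cong₂ ℤ._*_ (p 0) (q 0)) (sym (⊛-zero f' g')))
⊛-cong {f} {f'} {g} {g'} p q (suc n) = begin
  (f ⊛ g) (suc n)                                 ≡⟨ ⊛-suc f g n ⟩
  f 0 ℤ.* g (suc n) ℤ.+ (tl f ⊛ g) n              ≡⟨ cong₂ ℤ._+_ (cong₂ ℤ._*_ (p 0) (q (suc n))) (⊛-cong (p ∘ suc) q n) ⟩
  f' 0 ℤ.* g' (suc n) ℤ.+ (tl f' ⊛ g') n          ≡⟨ ⊛-suc f' g' n ⟨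
  (f' ⊛ g') (suc n)                               ∎
  where open ≡-Reasoning

-- The mirror image of `⊛-suc`. Commutativity needs it, because exchanging the factors turns a
-- peeled left factor into a peeled right one.
⊛-sucʳ : ∀ f g n → (f ⊛ g) (suc n) ≡ f (suc n) ℤ.* g 0 ℤ.+ (f ⊛ tl g) n
⊛-sucʳ f g zero = begin
  (f ⊛ g) 1                               ≡⟨ ⊛-suc f g 0 ⟩
  f 0 ℤ.* g 1 ℤ.+ (tl f ⊛ g) 0            ≡⟨ cong (λ z → f 0 ℤ.* g 1 ℤ.+ z) (⊛-zero (tl f) g) ⟩
  f 0 ℤ.* g 1 ℤ.+ f 1 ℤ.* g 0             ≡⟨ ℤ.+-comm (f 0 ℤ.* g 1) (f 1 ℤ.* g 0) ⟩
  f 1 ℤ.* g 0 ℤ.+ f 0 ℤ.* g 1             ≡⟨ cong (λ z → f 1 ℤ.* g 0 ℤ.+ z) (⊛-zero f (tl g)) ⟨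
  f 1 ℤ.* g 0 ℤ.+ (f ⊛ tl g) 0            ∎
  where open ≡-Reasoning
⊛-sucʳ f g (suc n) = begin
  (f ⊛ g) (suc (suc n))                                           ≡⟨ ⊛-suc f g (suc n) ⟩
  f 0 ℤ.* g (suc (suc n)) ℤ.+ (tl f ⊛ g) (suc n)                  ≡⟨ cong (λ z → f 0 ℤ.* g (suc (suc n)) ℤ.+ z) (⊛-sucʳ (tl f) g n) ⟩
  f 0 ℤ.* g (suc (suc n)) ℤ.+ (f (suc (suc n)) ℤ.* g 0 ℤ.+ (tl f ⊛ tl g) n)
    ≡⟨ swap (f 0 ℤ.* g (suc (suc n))) (f (suc (suc n)) ℤ.* g 0) ((tl f ⊛ tl g) n) ⟩
  f (suc (suc n)) ℤ.* g 0 ℤ.+ (f 0 ℤ.* g (suc (suc n)) ℤ.+ (tl f ⊛ tl g) n) ≡⟨ cong (λ z → f (suc (suc n)) ℤ.* g 0 ℤ.+ z) (⊛-suc f (tl g) n) ⟨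
  f (suc (suc n)) ℤ.* g 0 ℤ.+ (f ⊛ tl g) (suc n)                  ∎
  where
  open ≡-Reasoning
  swap : ∀ a b c → a ℤ.+ (b ℤ.+ c) ≡ b ℤ.+ (a ℤ.+ c)
  swap = ℤSolver.solve-∀

⊛-comm : ∀ f g → f ⊛ g ≈ g ⊛ f
⊛-comm f g zero = trans (⊛-zero f g) (trans (ℤ.*-comm (f 0) (g 0)) (sym (⊛-zero g f)))
⊛-comm f g (suc n) = trans (⊛-suc f g n)
  (trans (cong₂ ℤ._+_ (ℤ.*-comm (f 0) (g (suc n))) (⊛-comm (tl f) g n)) (sym (⊛-sucʳ g f n)))

⊛-distribʳ : ∀ h f g → (f ⊕ g) ⊛ h ≈ (f ⊛ h) ⊕ (g ⊛ h)
⊛-distribʳ h f g zero = trans (⊛-zero (f ⊕ g) h)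
  (trans (ℤ.*-distribʳ-+ (h 0) (f 0) (g 0)) (sym (cong₂ ℤ._+_ (⊛-zero f h) (⊛-zero g h))))
⊛-distribʳ h f g (suc n) = begin
  ((f ⊕ g) ⊛ h) (suc n)                                                 ≡⟨ ⊛-suc (f ⊕ g) h n ⟩
  (f 0 ℤ.+ g 0) ℤ.* h (suc n) ℤ.+ ((tl f ⊕ tl g) ⊛ h) n                 ≡⟨ cong (λ z → (f 0 ℤ.+ g 0) ℤ.* h (suc n) ℤ.+ z) (⊛-distribʳ h (tl f) (tl g) n) ⟩
  (f 0 ℤ.+ g 0) ℤ.* h (suc n) ℤ.+ ((tl f ⊛ h) n ℤ.+ (tl g ⊛ h) n)       ≡⟨ mid (f 0) (g 0) (h (suc n)) _ _ ⟩
  (f 0 ℤ.* h (suc n) ℤ.+ (tl f ⊛ h) n) ℤ.+ (g 0 ℤ.* h (suc n) ℤ.+ (tl g ⊛ h) n) ≡⟨ cong₂ ℤ._+_ (⊛-suc f h n) (⊛-suc g h n) ⟨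
  ((f ⊛ h) ⊕ (g ⊛ h)) (suc n)                                           ∎
  where
  open ≡-Reasoning
  mid : ∀ a b c d e → (a ℤ.+ b) ℤ.* c ℤ.+ (d ℤ.+ e) ≡ (a ℤ.* c ℤ.+ d) ℤ.+ (b ℤ.* c ℤ.+ e)
  mid = ℤSolver.solve-∀

scale : ℤ → PS → PS
scale c f n = c ℤ.* f n

scale-⊛ : ∀ c f g → scale c f ⊛ g ≈ scale c (f ⊛ g)
scale-⊛ c f g zero = trans (⊛-zero (scale c f) g) (trans (ℤ.*-assoc c (f 0) (g 0)) (cong (c ℤ.*_) (sym (⊛-zero f g))))
scale-⊛ c f g (suc n) = begin
  (scale c f ⊛ g) (suc n)                                   ≡⟨ ⊛-suc (scale c f) g n ⟩
  c ℤ.* f 0 ℤ.* g (suc n) ℤ.+ (scale c (tl f) ⊛ g) n        ≡⟨ cong (λ z → c ℤ.* f 0 ℤ.* g (suc n) ℤ.+ z) (scale-⊛ c (tl f) g n) ⟩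
  c ℤ.* f 0 ℤ.* g (suc n) ℤ.+ c ℤ.* (tl f ⊛ g) n            ≡⟨ fact c (f 0) (g (suc n)) _ ⟩
  c ℤ.* (f 0 ℤ.* g (suc n) ℤ.+ (tl f ⊛ g) n)                ≡⟨ cong (c ℤ.*_) (⊛-suc f g n) ⟨
  scale c (f ⊛ g) (suc n)                                   ∎
  where
  open ≡-Reasoning
  fact : ∀ a b c d → a ℤ.* b ℤ.* c ℤ.+ a ℤ.* d ≡ a ℤ.* (b ℤ.* c ℤ.+ d)
  fact = ℤSolver.solve-∀

⊛-assoc : ∀ f g h → (f ⊛ g) ⊛ h ≈ f ⊛ (g ⊛ h)
⊛-assoc f g h zero = begin
  ((f ⊛ g) ⊛ h) 0         ≡⟨ ⊛-zero (f ⊛ g) h ⟩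
  (f ⊛ g) 0 ℤ.* h 0       ≡⟨ cong (ℤ._* h 0) (⊛-zero f g) ⟩
  f 0 ℤ.* g 0 ℤ.* h 0     ≡⟨ ℤ.*-assoc (f 0) (g 0) (h 0) ⟩
  f 0 ℤ.* (g 0 ℤ.* h 0)   ≡⟨ cong (f 0 ℤ.*_) (⊛-zero g h) ⟨
  f 0 ℤ.* (g ⊛ h) 0       ≡⟨ ⊛-zero f (g ⊛ h) ⟨
  (f ⊛ (g ⊛ h)) 0         ∎
  where open ≡-Reasoning
⊛-assoc f g h (suc n) = begin
  ((f ⊛ g) ⊛ h) (suc n)
    ≡⟨ ⊛-suc (f ⊛ g) h n ⟩
  (f ⊛ g) 0 ℤ.* h (suc n) ℤ.+ (tl (f ⊛ g) ⊛ h) n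
    -- By `⊛-suc` the tail of `f ⊛ g` is `scale (f 0) (tl g) ⊕ (tl f ⊛ g)`, which is why `scale`
    -- enters.
    ≡⟨ cong₂ ℤ._+_ (cong (ℤ._* h (suc n)) (⊛-zero f g)) (⊛-cong {g = h} {h} (⊛-suc f g) (λ _ → refl) n) ⟩
  f 0 ℤ.* g 0 ℤ.* h (suc n) ℤ.+ ((scale (f 0) (tl g) ⊕ (tl f ⊛ g)) ⊛ h) n
    ≡⟨ cong (λ z → f 0 ℤ.* g 0 ℤ.* h (suc n) ℤ.+ z) (⊛-distribʳ h (scale (f 0) (tl g)) (tl f ⊛ g) n) ⟩
  f 0 ℤ.* g 0 ℤ.* h (suc n) ℤ.+ ((scale (f 0) (tl g) ⊛ h) n ℤ.+ ((tl f ⊛ g) ⊛ h) n)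
    ≡⟨ cong₂ (λ y z → f 0 ℤ.* g 0 ℤ.* h (suc n) ℤ.+ (y ℤ.+ z)) (scale-⊛ (f 0) (tl g) h n) (⊛-assoc (tl f) g h n) ⟩
  f 0 ℤ.* g 0 ℤ.* h (suc n) ℤ.+ (f 0 ℤ.* (tl g ⊛ h) n ℤ.+ (tl f ⊛ (g ⊛ h)) n)
    ≡⟨ fact (f 0) (g 0) (h (suc n)) _ _ ⟩
  f 0 ℤ.* (g 0 ℤ.* h (suc n) ℤ.+ (tl g ⊛ h) n) ℤ.+ (tl f ⊛ (g ⊛ h)) n
    ≡⟨ cong (λ z → f 0 ℤ.* z ℤ.+ (tl f ⊛ (g ⊛ h)) n) (⊛-suc g h n) ⟨
  f 0 ℤ.* (g ⊛ h) (suc n) ℤ.+ (tl f ⊛ (g ⊛ h)) n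
    ≡⟨ ⊛-suc f (g ⊛ h) n ⟨
  (f ⊛ (g ⊛ h)) (suc n) ∎
  where
  open ≡-Reasoning
  fact : ∀ a b c d e → a ℤ.* b ℤ.* c ℤ.+ (a ℤ.* d ℤ.+ e) ≡ a ℤ.* (b ℤ.* c ℤ.+ d) ℤ.+ e
  fact = ℤSolver.solve-∀

⊛-zeroˡ : ∀ f → 0PS ⊛ f ≈ 0PS
⊛-zeroˡ f zero    = trans (⊛-zero 0PS f) (ℤ.*-zeroˡ (f 0))
⊛-zeroˡ f (suc n) = trans (⊛-suc 0PS f n) (cong₂ ℤ._+_ (ℤ.*-zeroˡ (f (suc n))) (⊛-zeroˡ f n))

⊛-identityˡ : ∀ f → 1PS ⊛ f ≈ f
⊛-identityˡ f zero    = trans (⊛-zero 1PS f) (ℤ.*-identityˡ (f 0))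
⊛-identityˡ f (suc n) = trans (⊛-suc 1PS f n)
  (trans (cong₂ ℤ._+_ (ℤ.*-identityˡ (f (suc n))) (⊛-zeroˡ f n)) (ℤ.+-identityʳ _))

PS-commutativeRing : CommutativeRing 0ℓ 0ℓ
PS-commutativeRing = record
  { Carrier = PS
  ; _≈_ = _≈_
  ; _+_ = _⊕_
  ; _*_ = _⊛_
  ; -_ = ⊝_
  ; 0# = 0PS
  ; 1# = 1PS
  ; isCommutativeRing = record
    { isRing = record
      { +-isAbelianGroup = record
        { isGroup = record
          { isMonoid = record
            { isSemigroup = record
              { isMagma = record
                { isEquivalence = record
                  { refl = λ _ → refl ; sym = λ p n → sym (p n) ; trans = λ p q n → trans (p n) (q n) }
                ; ∙-cong = λ p q n → cong₂ ℤ._+_ (p n) (q n) }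
              ; assoc = λ f g h n → ℤ.+-assoc (f n) (g n) (h n) }
            ; identity = (λ f n → ℤ.+-identityˡ (f n)) , (λ f n → ℤ.+-identityʳ (f n)) }
          ; inverse = (λ f n → ℤ.+-inverseˡ (f n)) , (λ f n → ℤ.+-inverseʳ (f n))
          ; ⁻¹-cong = λ p n → cong ℤ.-_ (p n) }
        ; comm = λ f g n → ℤ.+-comm (f n) (g n) }
      ; *-cong = λ {f} {f'} {g} {g'} → ⊛-cong {f} {f'} {g} {g'}
      ; *-assoc = ⊛-assoc
      ; *-identity = ⊛-identityˡ , λ f n → trans (⊛-comm f 1PS n) (⊛-identityˡ f n)
      ; distrib = (λ f g h n → trans (⊛-comm f (g ⊕ h) n) (trans (⊛-distribʳ f g h n)
                     (cong₂ ℤ._+_ (⊛-comm g f n) (⊛-comm h f n))))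
                , ⊛-distribʳ }
    ; *-comm = ⊛-comm } }

const : ℤ → PS
const c = poly (c ∷ [])

module PSR = CommutativeRing PS-commutativeRing

const-⊛ : ∀ c f → const c ⊛ f ≈ scale c f
const-⊛ c f zero    = ⊛-zero (const c) f
const-⊛ c f (suc n) = trans (⊛-suc (const c) f n) (trans (cong (λ z → c ℤ.* f (suc n) ℤ.+ z) (⊛-zeroˡ f n)) (ℤ.+-identityʳ _))

-- The ring solver takes its coefficients from the integers, whose equality is decidable, unlike
-- that of series.
morphism : ℤ.+-*-rawRing -Raw-AlmostCommutative⟶ fromCommutativeRing PS-commutativeRing
morphism = record
  { ⟦_⟧ = const
  ; +-homo = λ { _ _ zero → refl ; _ _ (suc n) → refl }
  ; *-homo = λ { a b n → sym (trans (const-⊛ a (const b) n) (lem a b n)) }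
  ; -‿homo = λ { _ zero → refl ; _ (suc n) → refl }
  ; 0-homo = λ { zero → refl ; (suc n) → refl }
  ; 1-homo = λ _ → refl }
  where
  lem : ∀ a b → scale a (const b) ≈ const (a ℤ.* b)
  lem a b zero = refl
  lem a b (suc n) = ℤ.*-zeroʳ a

const-≟ : ∀ a b → Maybe (const a ≈ const b)
const-≟ a b = Maybe.map (λ { refl _ → refl }) (dec⇒weaklyDec ℤ._≟_ a b)

open Algebra.Solver.Ring ℤ.+-*-rawRing (fromCommutativeRing PS-commutativeRing) morphism
  const-≟ using (solve; con; _:=_; _:+_; _:*_; _:-_; :-_)

X⊛-zero : ∀ f → (X ⊛ f) 0 ≡ + 0
X⊛-zero f = trans (⊛-zero X f) (ℤ.*-zeroˡ (f 0))

X⊛-suc : ∀ f n → (X ⊛ f) (suc n) ≡ f n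
X⊛-suc f n = trans (⊛-suc X f n) (trans (cong₂ ℤ._+_ (ℤ.*-zeroˡ (f (suc n))) (⊛-identityˡ f n)) (ℤ.+-identityˡ _))

poly-∷ : ∀ c cs → poly (c ∷ cs) ≈ const c ⊕ X ⊛ poly cs
poly-∷ c cs zero    = sym (trans (cong (λ z → c ℤ.+ z) (X⊛-zero (poly cs))) (ℤ.+-identityʳ c))
poly-∷ c cs (suc n) = sym (trans (ℤ.+-identityˡ _) (X⊛-suc (poly cs) n))

≈⇒diff≈0 : ∀ {f g} → f ≈ g → f ⊖ g ≈ 0PS
≈⇒diff≈0 {f} {g} p n = ℤ.i≡j⇒i-j≡0 (p n)

open PSR using (+-cong; *-cong; zeroʳ)
module ≈-Reasoning = Relation.Binary.Reasoning.Setoid PSR.setoid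

-- The quadratic equation for F and its discriminant

module _ where
  open ≈-Reasoning

  0-coeff : ∀ a {b} → b ≈ 0PS → a ⊛ b ≈ 0PS
  0-coeff a p = PSR.trans (*-cong {a} PSR.refl p) (zeroʳ a)

  -- The right-hand side is completed by multiples of the (zero) differences of the two sides of hF′, hO and hC.
  functional-equation : ∀ {C F J H N O} →
    F ≈ 1PS ⊕ X ⊛ (J ⊛ F) → J ≈ F ⊕ H → H ≈ O ⊛ N → O ≈ 1PS ⊕ X ⊛ O →
    N ≈ X ⊛ (C ⊛ (C ⊖ 1PS)) → C ≈ 1PS ⊕ X ⊛ (C ⊛ C) →
    F ≈ (1PS ⊖ X) ⊛ (1PS ⊕ X ⊛ C ⊛ F ⊕ X ⊛ F ⊛ F)
  functional-equation {C} {F} {J} {H} {N} {O} hF hJ hH hO hN hC = begin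
    F ≈⟨ solve 4 (λ x c f o → let 𝟙 = con (+ 1) in
           f := (𝟙 :- x) :* (𝟙 :+ x :* c :* f :+ x :* f :* f)
                :+ ((𝟙 :- x) :* (f :- (𝟙 :+ x :* ((f :+ o :* (x :* (c :* (c :- 𝟙)))) :* f)))
                :+ (x :* x :* c :* (c :- 𝟙) :* f :* (o :- (𝟙 :+ x :* o))
                :+ (:- (x :* f)) :* (c :- (𝟙 :+ x :* (c :* c))))))
           PSR.refl X C F O ⟩
    G ⊕ ((1PS ⊖ X) ⊛ (F ⊖ (1PS ⊕ X ⊛ ((F ⊕ O ⊛ (X ⊛ (C ⊛ (C ⊖ 1PS)))) ⊛ F))) ⊕ (X ⊛ X ⊛ C ⊛ (C ⊖ 1PS) ⊛ F ⊛ (O ⊖ (1PS ⊕ X ⊛ O)) ⊕ (⊝ (X ⊛ F)) ⊛ (C ⊖ (1PS ⊕ X ⊛ (C ⊛ C)))))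
      ≈⟨ +-cong {G} PSR.refl (+-cong (0-coeff (1PS ⊖ X) (≈⇒diff≈0 hF′)) (+-cong (0-coeff (X ⊛ X ⊛ C ⊛ (C ⊖ 1PS) ⊛ F) (≈⇒diff≈0 hO)) (0-coeff (⊝ (X ⊛ F)) (≈⇒diff≈0 hC)))) ⟩
    G ⊕ (0PS ⊕ (0PS ⊕ 0PS)) ≈⟨ (λ n → ℤ.+-identityʳ (G n)) ⟩
    G ∎
    where
    G = (1PS ⊖ X) ⊛ (1PS ⊕ X ⊛ C ⊛ F ⊕ X ⊛ F ⊛ F)
    hJ' : J ≈ F ⊕ O ⊛ (X ⊛ (C ⊛ (C ⊖ 1PS)))
    hJ' = PSR.trans hJ (+-cong {F} PSR.refl (PSR.trans hH (*-cong {O} PSR.refl hN)))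
    hF′ : F ≈ 1PS ⊕ X ⊛ ((F ⊕ O ⊛ (X ⊛ (C ⊛ (C ⊖ 1PS)))) ⊛ F)
    hF′ = PSR.trans hF (+-cong {1PS} PSR.refl (*-cong {X} PSR.refl (*-cong {J} {_} {F} hJ' PSR.refl)))

  -- With q = 1 - x(1 - x)C the equation for F is x(1 - x)F² - qF + (1 - x) = 0, so S = q - 2x(1 -
  -- x)F has square q² - 4x(1 - x)². The Catalan equation turns the term x²(1 - x)²C² of q² into x(1
  -- - x)²(C - 1). The polynomial part becomes 1 - 5x(1 - x)², the 5 being 4 + 1.
  discriminant : ∀ {C F} → C ≈ 1PS ⊕ X ⊛ (C ⊛ C) →
    F ≈ (1PS ⊖ X) ⊛ (1PS ⊕ X ⊛ C ⊛ F ⊕ X ⊛ F ⊛ F) →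
    let S = (1PS ⊖ X ⊛ (1PS ⊖ X) ⊛ C) ⊖ const (+ 2) ⊛ X ⊛ (1PS ⊖ X) ⊛ F in
    S ⊛ S ≈ poly (+ 1 ∷ -[1+ 4 ] ∷ + 10 ∷ -[1+ 4 ] ∷ []) ⊖ X ⊛ (1PS ⊖ X) ⊛ (1PS ⊕ X) ⊛ C
  discriminant {C} {F} hC hF = begin
    _ ≈⟨ solve 3 (λ x c f → let 𝟙 = con (+ 1); s = (𝟙 :- x :* (𝟙 :- x) :* c) :- con (+ 2) :* x :* (𝟙 :- x) :* f in
           s :* s := con (+ 1) :+ x :* (con (-[1+ 4 ]) :+ x :* (con (+ 10) :+ x :* con (-[1+ 4 ]))) :- x :* (𝟙 :- x) :* (𝟙 :+ x) :* c
             :+ ((:- (con (+ 4) :* x :* (𝟙 :- x))) :* (f :- (𝟙 :- x) :* (𝟙 :+ x :* c :* f :+ x :* f :* f))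
             :+ (:- (x :* (𝟙 :- x) :* (𝟙 :- x))) :* (c :- (𝟙 :+ x :* (c :* c)))))
           PSR.refl X C F ⟩
    Q ⊖ E ⊕ ((⊝ (const (+ 4) ⊛ X ⊛ (1PS ⊖ X))) ⊛ (F ⊖ (1PS ⊖ X) ⊛ (1PS ⊕ X ⊛ C ⊛ F ⊕ X ⊛ F ⊛ F))
      ⊕ (⊝ (X ⊛ (1PS ⊖ X) ⊛ (1PS ⊖ X))) ⊛ (C ⊖ (1PS ⊕ X ⊛ (C ⊛ C))))
      ≈⟨ +-cong {Q ⊖ E} PSR.refl (+-cong (0-coeff (⊝ (const (+ 4) ⊛ X ⊛ (1PS ⊖ X))) (≈⇒diff≈0 hF)) (0-coeff (⊝ (X ⊛ (1PS ⊖ X) ⊛ (1PS ⊖ X))) (≈⇒diff≈0 hC))) ⟩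
    Q ⊖ E ⊕ (0PS ⊕ 0PS) ≈⟨ (λ n → ℤ.+-identityʳ ((Q ⊖ E) n)) ⟩
    Q ⊖ E ≈⟨ +-cong {Q} {_} {⊝ E} Q≈ PSR.refl ⟩
    poly (+ 1 ∷ -[1+ 4 ] ∷ + 10 ∷ -[1+ 4 ] ∷ []) ⊖ E ∎
    where
    Q = const (+ 1) ⊕ X ⊛ (const (-[1+ 4 ]) ⊕ X ⊛ (const (+ 10) ⊕ X ⊛ const (-[1+ 4 ])))
    E = X ⊛ (1PS ⊖ X) ⊛ (1PS ⊕ X) ⊛ C
    Q≈ : Q ≈ poly (+ 1 ∷ -[1+ 4 ] ∷ + 10 ∷ -[1+ 4 ] ∷ [])
    Q≈ = PSR.sym (PSR.trans (poly-∷ _ _) (+-cong {const (+ 1)} PSR.refl (*-cong {X} PSR.refl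
          (PSR.trans (poly-∷ _ _) (+-cong {const -[1+ 4 ]} PSR.refl (*-cong {X} PSR.refl (poly-∷ _ _)))))))

-- The Euler operator x·d/dx.
θ : PS → PS
θ f n = + n ℤ.* f n

θ-product : ∀ f g → θ (f ⊛ g) ≈ θ f ⊛ g ⊕ f ⊛ θ g
θ-product f g zero = begin
  + 0 ℤ.* (f ⊛ g) 0 ≡⟨ ℤ.*-zeroˡ ((f ⊛ g) 0) ⟩
  + 0 ≡⟨ cong₂ ℤ._+_ (trans (cong (ℤ._* g 0) (ℤ.*-zeroˡ (f 0))) (ℤ.*-zeroˡ (g 0))) (trans (cong (f 0 ℤ.*_) (ℤ.*-zeroˡ (g 0))) (ℤ.*-zeroʳ (f 0))) ⟨
  θ f 0 ℤ.* g 0 ℤ.+ f 0 ℤ.* θ g 0 ≡⟨ cong₂ ℤ._+_ (⊛-zero (θ f) g) (⊛-zero f (θ g)) ⟨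
  (θ f ⊛ g ⊕ f ⊛ θ g) 0 ∎
  where open ≡-Reasoning
θ-product f g (suc n) = begin
  + suc n ℤ.* (f ⊛ g) (suc n)
    ≡⟨ cong (+ suc n ℤ.*_) (⊛-suc f g n) ⟩
  + suc n ℤ.* (f 0 ℤ.* g (suc n) ℤ.+ (tl f ⊛ g) n)
    ≡⟨ split (+ n) (f 0) (g (suc n)) _ ⟩
  f 0 ℤ.* (+ suc n ℤ.* g (suc n)) ℤ.+ ((tl f ⊛ g) n ℤ.+ θ (tl f ⊛ g) n)
    ≡⟨ cong (λ z → f 0 ℤ.* (+ suc n ℤ.* g (suc n)) ℤ.+ ((tl f ⊛ g) n ℤ.+ z)) (θ-product (tl f) g n) ⟩
  f 0 ℤ.* (+ suc n ℤ.* g (suc n)) ℤ.+ ((tl f ⊛ g) n ℤ.+ ((θ (tl f) ⊛ g) n ℤ.+ (tl f ⊛ θ g) n))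
    ≡⟨ regroup (f 0 ℤ.* (+ suc n ℤ.* g (suc n))) ((tl f ⊛ g) n) ((θ (tl f) ⊛ g) n) ((tl f ⊛ θ g) n) (f 0) (g (suc n)) ⟩
  (θ f 0 ℤ.* g (suc n) ℤ.+ ((tl f ⊛ g) n ℤ.+ (θ (tl f) ⊛ g) n)) ℤ.+ (f 0 ℤ.* θ g (suc n) ℤ.+ (tl f ⊛ θ g) n)
    -- The tail of `θ f` is `tl f ⊕ θ (tl f)`: the shift of the index contributes one extra copy of
    -- `tl f`.
    ≡⟨ cong (λ z → (θ f 0 ℤ.* g (suc n) ℤ.+ z) ℤ.+ (f 0 ℤ.* θ g (suc n) ℤ.+ (tl f ⊛ θ g) n)) (trans (sym (⊛-distribʳ g (tl f) (θ (tl f)) n)) (⊛-cong {g = g} (λ k → tail-θ (+ k) (f (suc k))) (λ _ → refl) n)) ⟩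
  (θ f 0 ℤ.* g (suc n) ℤ.+ (tl (θ f) ⊛ g) n) ℤ.+ (f 0 ℤ.* θ g (suc n) ℤ.+ (tl f ⊛ θ g) n)
    ≡⟨ cong₂ ℤ._+_ (⊛-suc (θ f) g n) (⊛-suc f (θ g) n) ⟨
  (θ f ⊛ g ⊕ f ⊛ θ g) (suc n) ∎
  where
  open ≡-Reasoning
  split : ∀ n a b c → (+ 1 ℤ.+ n) ℤ.* (a ℤ.* b ℤ.+ c) ≡ a ℤ.* ((+ 1 ℤ.+ n) ℤ.* b) ℤ.+ (c ℤ.+ n ℤ.* c)
  split = ℤSolver.solve-∀
  regroup : ∀ a b c d x y → a ℤ.+ (b ℤ.+ (c ℤ.+ d)) ≡ (+ 0 ℤ.* x ℤ.* y ℤ.+ (b ℤ.+ c)) ℤ.+ (a ℤ.+ d)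
  regroup = ℤSolver.solve-∀
  tail-θ : ∀ k x → x ℤ.+ k ℤ.* x ≡ (+ 1 ℤ.+ k) ℤ.* x
  tail-θ = ℤSolver.solve-∀

-- The Catalan numbers

nCk*k!*[n∸k]! : ∀ {n k} → k ≤ n → (n choose k) ℕ.* (k ! ℕ.* (n ∸ k) !) ≡ n !
nCk*k!*[n∸k]! {n} {k} k≤n = trans (cong (ℕ._* (k ! ℕ.* (n ∸ k) !)) (nCk≡n!/k![n-k]! k≤n))
  (m/n*n≡m {{ℕ.m*n≢0 (k !) _ {{ℕ._!≢0 k}} {{ℕ._!≢0 (n ∸ k)}}}} (k![n∸k]!∣n! k≤n))

central : ℕ → ℕ
central n = (2 ℕ.* n) choose n

central*n!*n! : ∀ n → central n ℕ.* (n ! ℕ.* n !) ≡ (2 ℕ.* n) !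
central*n!*n! n = trans (cong (λ k → central n ℕ.* (n ! ℕ.* k !)) (sym 2n∸n≡n)) (nCk*k!*[n∸k]! (ℕ.m≤m+n n _))
  where
  2n∸n≡n : 2 ℕ.* n ∸ n ≡ n
  2n∸n≡n = trans (ℕ.m+n∸m≡n n (n ℕ.+ 0)) (ℕ.+-identityʳ n)

-- Multiplied by n!(n + 1)!, both sides become (2n + 2)!.
central-suc : ∀ n → suc n ℕ.* central (suc n) ≡ 2 ℕ.* suc (2 ℕ.* n) ℕ.* central n
central-suc n = ℕ.*-cancelʳ-≡ _ _ (n ! ℕ.* (suc n) !) {{nz}} (begin
  suc n ℕ.* central (suc n) ℕ.* (n ! ℕ.* (suc n) !)            ≡⟨ e₁ n (central (suc n)) (n !) ⟩
  central (suc n) ℕ.* ((suc n) ! ℕ.* (suc n) !)                ≡⟨ central*n!*n! (suc n) ⟩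
  (2 ℕ.* suc n) !                                              ≡⟨ cong _! (ℕ.*-suc 2 n) ⟩
  (2 ℕ.+ 2 ℕ.* n) !                                            ≡⟨⟩
  (2 ℕ.+ 2 ℕ.* n) ℕ.* (suc (2 ℕ.* n) ℕ.* (2 ℕ.* n) !)          ≡⟨ cong (λ z → (2 ℕ.+ 2 ℕ.* n) ℕ.* (suc (2 ℕ.* n) ℕ.* z)) (central*n!*n! n) ⟨
  (2 ℕ.+ 2 ℕ.* n) ℕ.* (suc (2 ℕ.* n) ℕ.* (central n ℕ.* (n ! ℕ.* n !))) ≡⟨ e₂ n (central n) (n !) ⟩
  2 ℕ.* suc (2 ℕ.* n) ℕ.* central n ℕ.* (n ! ℕ.* (suc n) !)    ∎)
  where
  open ≡-Reasoning
  nz : NonZero (n ! ℕ.* (suc n) !)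
  nz = ℕ.m*n≢0 (n !) _ {{ℕ._!≢0 n}} {{ℕ._!≢0 (suc n)}}
  e₁ : ∀ n c f → (1 ℕ.+ n) ℕ.* c ℕ.* (f ℕ.* ((1 ℕ.+ n) ℕ.* f)) ≡ c ℕ.* (((1 ℕ.+ n) ℕ.* f) ℕ.* ((1 ℕ.+ n) ℕ.* f))
  e₁ = ℕSolver.solve-∀
  e₂ : ∀ n c f → (2 ℕ.+ 2 ℕ.* n) ℕ.* ((1 ℕ.+ 2 ℕ.* n) ℕ.* (c ℕ.* (f ℕ.* f))) ≡ 2 ℕ.* (1 ℕ.+ 2 ℕ.* n) ℕ.* c ℕ.* (f ℕ.* ((1 ℕ.+ n) ℕ.* f))
  e₂ = ℕSolver.solve-∀

-- The division in `catalan` is exact. For m ≥ 1 absorption gives (m + 1)·binom(2m, m + 1) =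
-- m·binom(2m, m), so m + 1 divides m·binom(2m, m). It also divides (m + 1)·binom(2m, m), hence the
-- difference.
suc∣central : ∀ n → suc n ∣ central n
suc∣central zero = divides-refl 1
suc∣central (suc n) = ∣m+n∣m⇒∣n (subst (suc (suc n) ∣_) eq (m∣m*n (central (suc n)))) (subst (suc (suc n) ∣_) absorb (m∣m*n ((2 ℕ.* suc n) choose suc (suc n))))
  where
  open ≡-Reasoning
  m = suc n
  2m = 2 ℕ.* m
  eq : suc m ℕ.* central m ≡ m ℕ.* central m ℕ.+ central m
  eq = ℕ.+-comm (central m) _
  2m≡ : 2m ≡ suc m ℕ.+ n
  2m≡ = trans (cong (λ z → suc (n ℕ.+ suc z)) (ℕ.+-identityʳ n)) (cong suc (ℕ.+-suc n n))
  2m∸ : 2m ∸ suc m ≡ n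
  2m∸ = trans (cong (_∸ suc m) 2m≡) (ℕ.m+n∸m≡n (suc m) n)
  e₁ : ∀ n k f → (2 ℕ.+ n) ℕ.* k ℕ.* ((1 ℕ.+ n) ℕ.* f ℕ.* f) ≡ k ℕ.* ((2 ℕ.+ n) ℕ.* ((1 ℕ.+ n) ℕ.* f) ℕ.* f)
  e₁ = ℕSolver.solve-∀
  e₂ : ∀ n k f → k ℕ.* ((1 ℕ.+ n) ℕ.* f ℕ.* ((1 ℕ.+ n) ℕ.* f)) ≡ (1 ℕ.+ n) ℕ.* k ℕ.* ((1 ℕ.+ n) ℕ.* f ℕ.* f)
  e₂ = ℕSolver.solve-∀
  absorb : suc m ℕ.* (2m choose suc m) ≡ m ℕ.* central m
  absorb = ℕ.*-cancelʳ-≡ _ _ (m ! ℕ.* n !) {{ℕ.m*n≢0 (m !) _ {{ℕ._!≢0 m}} {{ℕ._!≢0 n}}}} (begin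
    suc m ℕ.* (2m choose suc m) ℕ.* (m ! ℕ.* n !)          ≡⟨ e₁ n (2m choose suc m) (n !) ⟩
    (2m choose suc m) ℕ.* ((suc m) ! ℕ.* n !)              ≡⟨ cong (λ k → (2m choose suc m) ℕ.* ((suc m) ! ℕ.* k !)) 2m∸ ⟨
    (2m choose suc m) ℕ.* ((suc m) ! ℕ.* (2m ∸ suc m) !)   ≡⟨ nCk*k!*[n∸k]! (subst (suc m ≤_) (sym 2m≡) (ℕ.m≤m+n (suc m) n)) ⟩
    2m !                                              ≡⟨ central*n!*n! m ⟨
    central m ℕ.* (m ! ℕ.* m !)                       ≡⟨ e₂ n (central m) (n !) ⟩
    m ℕ.* central m ℕ.* (m ! ℕ.* n !)                 ∎)

catalan*suc : ∀ n → catalan n ℕ.* suc n ≡ central n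
catalan*suc n = m/n*n≡m (suc∣central n)

catalan-suc : ∀ n → suc (suc n) ℕ.* catalan (suc n) ≡ 2 ℕ.* suc (2 ℕ.* n) ℕ.* catalan n
catalan-suc n = ℕ.*-cancelʳ-≡ _ _ (suc n) (begin
  suc (suc n) ℕ.* catalan (suc n) ℕ.* suc n    ≡⟨ e (suc (suc n)) (catalan (suc n)) (suc n) ⟩
  suc n ℕ.* (catalan (suc n) ℕ.* suc (suc n))  ≡⟨ cong (suc n ℕ.*_) (catalan*suc (suc n)) ⟩
  suc n ℕ.* central (suc n)                    ≡⟨ central-suc n ⟩
  2 ℕ.* suc (2 ℕ.* n) ℕ.* central n            ≡⟨ cong (2 ℕ.* suc (2 ℕ.* n) ℕ.*_) (catalan*suc n) ⟨
  2 ℕ.* suc (2 ℕ.* n) ℕ.* (catalan n ℕ.* suc n) ≡⟨ ℕ.*-assoc (2 ℕ.* suc (2 ℕ.* n)) (catalan n) (suc n) ⟨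
  2 ℕ.* suc (2 ℕ.* n) ℕ.* catalan n ℕ.* suc n  ∎)
  where
  open ≡-Reasoning
  e : ∀ a b c → a ℕ.* b ℕ.* c ≡ c ℕ.* (b ℕ.* a)
  e = ℕSolver.solve-∀

-- The y of the overview: 1 - 4x is the discriminant of xC² - C + 1 as a polynomial in C, and y is
-- to be its square root.
disc-root : PS
disc-root = 1PS ⊖ const (+ 2) ⊛ (X ⊛ Cat)

disc-root-suc : ∀ n → disc-root (suc n) ≡ -[1+ 1 ] ℤ.* Cat n
disc-root-suc n = trans (cong (λ z → + 0 ℤ.- z) (trans (const-⊛ (+ 2) (X ⊛ Cat) (suc n)) (cong (+ 2 ℤ.*_) (X⊛-suc Cat n)))) (e (Cat n))
  where
  e : ∀ c → + 0 ℤ.- + 2 ℤ.* c ≡ -[1+ 1 ] ℤ.* c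
  e = ℤSolver.solve-∀

disc-root-zero : disc-root 0 ≡ + 1
disc-root-zero = cong (λ z → + 1 ℤ.- z) (trans (const-⊛ (+ 2) (X ⊛ Cat) 0) (cong (+ 2 ℤ.*_) (X⊛-zero Cat)))

1-4X : PS
1-4X = 1PS ⊖ const (+ 4) ⊛ X

[1-4X]⊛-zero : ∀ f → (1-4X ⊛ f) 0 ≡ f 0
[1-4X]⊛-zero f = trans (⊛-zero 1-4X f) (ℤ.*-identityˡ (f 0))

[1-4X]⊛-suc : ∀ f n → (1-4X ⊛ f) (suc n) ≡ f (suc n) ℤ.- + 4 ℤ.* f n
[1-4X]⊛-suc f n = trans (solve 2 (λ x g → (con (+ 1) :- con (+ 4) :* x) :* g := g :- con (+ 4) :* (x :* g)) PSR.refl X f (suc n))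
  (cong (λ z → f (suc n) ℤ.- z) (trans (const-⊛ (+ 4) (X ⊛ f) (suc n)) (cong (+ 4 ℤ.*_) (X⊛-suc f n))))

const⊛X⊛-suc : ∀ k f n → (const k ⊛ (X ⊛ f)) (suc n) ≡ k ℤ.* f n
const⊛X⊛-suc k f n = trans (const-⊛ k (X ⊛ f) (suc n)) (cong (k ℤ.*_) (X⊛-suc f n))

-- From degree 2 on, each coefficient is an instance of `catalan-suc`. Degree 1 is separate, since
-- the constant term of y is 1 and not -2 times a Catalan number.
θ-disc-root : 1-4X ⊛ θ disc-root ≈ const -[1+ 1 ] ⊛ (X ⊛ disc-root)
θ-disc-root zero = trans ([1-4X]⊛-zero (θ disc-root)) (sym (trans (const-⊛ -[1+ 1 ] (X ⊛ disc-root) 0) (cong (-[1+ 1 ] ℤ.*_) (X⊛-zero disc-root))))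
θ-disc-root (suc n) = trans ([1-4X]⊛-suc (θ disc-root) n) (trans (go n) (sym (const⊛X⊛-suc -[1+ 1 ] disc-root n)))
  where
  open ≡-Reasoning
  go : ∀ n → θ disc-root (suc n) ℤ.- + 4 ℤ.* θ disc-root n ≡ -[1+ 1 ] ℤ.* disc-root n
  go zero = trans (cong (λ z → + 1 ℤ.* z ℤ.- + 4 ℤ.* (+ 0 ℤ.* disc-root 0)) (disc-root-suc 0)) (sym (cong (-[1+ 1 ] ℤ.*_) disc-root-zero))
  go (suc m) = begin
    + suc (suc m) ℤ.* disc-root (suc (suc m)) ℤ.- + 4 ℤ.* (+ suc m ℤ.* disc-root (suc m))
      ≡⟨ cong₂ (λ y z → + suc (suc m) ℤ.* y ℤ.- + 4 ℤ.* (+ suc m ℤ.* z)) (disc-root-suc (suc m)) (disc-root-suc m) ⟩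
    + suc (suc m) ℤ.* (-[1+ 1 ] ℤ.* Cat (suc m)) ℤ.- + 4 ℤ.* (+ suc m ℤ.* (-[1+ 1 ] ℤ.* Cat m))
      ≡⟨ e₁ (+ suc (suc m)) (Cat (suc m)) (+ suc m) (Cat m) ⟩
    -[1+ 1 ] ℤ.* (+ suc (suc m) ℤ.* Cat (suc m)) ℤ.+ + 8 ℤ.* (+ suc m ℤ.* Cat m)
      ≡⟨ cong (λ z → -[1+ 1 ] ℤ.* z ℤ.+ + 8 ℤ.* (+ suc m ℤ.* Cat m)) rec ⟩
    -[1+ 1 ] ℤ.* ((+ 2 ℤ.* (+ 1 ℤ.+ + 2 ℤ.* + m)) ℤ.* Cat m) ℤ.+ + 8 ℤ.* ((+ 1 ℤ.+ + m) ℤ.* Cat m)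
      ≡⟨ e₂ (+ m) (Cat m) ⟩
    -[1+ 1 ] ℤ.* (-[1+ 1 ] ℤ.* Cat m)
      ≡⟨ cong (-[1+ 1 ] ℤ.*_) (disc-root-suc m) ⟨
    -[1+ 1 ] ℤ.* disc-root (suc m) ∎
    where
    e₁ : ∀ a c b d → a ℤ.* (-[1+ 1 ] ℤ.* c) ℤ.- + 4 ℤ.* (b ℤ.* (-[1+ 1 ] ℤ.* d)) ≡ -[1+ 1 ] ℤ.* (a ℤ.* c) ℤ.+ + 8 ℤ.* (b ℤ.* d)
    e₁ = ℤSolver.solve-∀
    e₂ : ∀ m c → -[1+ 1 ] ℤ.* ((+ 2 ℤ.* (+ 1 ℤ.+ + 2 ℤ.* m)) ℤ.* c) ℤ.+ + 8 ℤ.* ((+ 1 ℤ.+ m) ℤ.* c) ≡ -[1+ 1 ] ℤ.* (-[1+ 1 ] ℤ.* c)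
    e₂ = ℤSolver.solve-∀
    rec : + suc (suc m) ℤ.* Cat (suc m) ≡ (+ 2 ℤ.* (+ 1 ℤ.+ + 2 ℤ.* + m)) ℤ.* Cat m
    rec = begin
      + suc (suc m) ℤ.* + catalan (suc m)               ≡⟨ ℤ.pos-* (suc (suc m)) (catalan (suc m)) ⟨
      + (suc (suc m) ℕ.* catalan (suc m))               ≡⟨ cong +_ (catalan-suc m) ⟩
      + (2 ℕ.* suc (2 ℕ.* m) ℕ.* catalan m)             ≡⟨ ℤ.pos-* (2 ℕ.* suc (2 ℕ.* m)) (catalan m) ⟩
      + (2 ℕ.* suc (2 ℕ.* m)) ℤ.* Cat m                 ≡⟨ cong (ℤ._* Cat m) (ℤ.pos-* 2 (suc (2 ℕ.* m))) ⟩
      (+ 2 ℤ.* (+ 1 ℤ.+ + (2 ℕ.* m))) ℤ.* Cat m         ≡⟨ cong (λ z → (+ 2 ℤ.* (+ 1 ℤ.+ z)) ℤ.* Cat m) (ℤ.pos-* 2 m) ⟩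
      (+ 2 ℤ.* (+ 1 ℤ.+ + 2 ℤ.* + m)) ℤ.* Cat m         ∎

disc : PS
disc = disc-root ⊛ disc-root

θ-disc : 1-4X ⊛ θ disc ≈ const -[1+ 3 ] ⊛ (X ⊛ disc)
θ-disc = begin
  1-4X ⊛ θ disc                                  ≈⟨ *-cong {1-4X} PSR.refl (θ-product disc-root disc-root) ⟩
  1-4X ⊛ (θ disc-root ⊛ disc-root ⊕ disc-root ⊛ θ disc-root)
    ≈⟨ solve 3 (λ a b y → a :* (b :* y :+ y :* b) := con (+ 2) :* ((a :* b) :* y)) PSR.refl 1-4X (θ disc-root) disc-root ⟩
  const (+ 2) ⊛ ((1-4X ⊛ θ disc-root) ⊛ disc-root) ≈⟨ *-cong {const (+ 2)} PSR.refl (*-cong {1-4X ⊛ θ disc-root} {_} {disc-root} θ-disc-root PSR.refl) ⟩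
  const (+ 2) ⊛ ((const -[1+ 1 ] ⊛ (X ⊛ disc-root)) ⊛ disc-root)
    ≈⟨ solve 2 (λ x y → con (+ 2) :* ((con -[1+ 1 ] :* (x :* y)) :* y) := con -[1+ 3 ] :* (x :* (y :* y))) PSR.refl X disc-root ⟩
  const -[1+ 3 ] ⊛ (X ⊛ disc) ∎
  where open ≈-Reasoning

-- Coefficientwise the differential equation says (n + 1)d(n + 1) = 4(n - 1)d(n). The factor n - 1
-- vanishes at n = 1 and ends the series after degree 1.
disc≈1-4X : disc ≈ 1-4X
disc≈1-4X = λ { zero → base ; (suc zero) → first ; (suc (suc n)) → trans (rest n) (sym (trans (cong (λ z → + 0 ℤ.- z) (const-⊛ (+ 4) X (suc (suc n)))) refl)) }
  where
  open ≡-Reasoning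
  rec : ∀ n → + suc n ℤ.* disc (suc n) ≡ + 4 ℤ.* (+ n ℤ.* disc n) ℤ.+ -[1+ 3 ] ℤ.* disc n
  rec n = begin
    + suc n ℤ.* disc (suc n)                                                         ≡⟨ e (+ suc n ℤ.* disc (suc n)) (+ 4 ℤ.* (+ n ℤ.* disc n)) ⟩
    + 4 ℤ.* (+ n ℤ.* disc n) ℤ.+ (+ suc n ℤ.* disc (suc n) ℤ.- + 4 ℤ.* (+ n ℤ.* disc n)) ≡⟨ cong (λ z → + 4 ℤ.* (+ n ℤ.* disc n) ℤ.+ z) (trans (sym ([1-4X]⊛-suc (θ disc) n)) (trans (θ-disc (suc n)) (const⊛X⊛-suc -[1+ 3 ] disc n))) ⟩
    + 4 ℤ.* (+ n ℤ.* disc n) ℤ.+ -[1+ 3 ] ℤ.* disc n ∎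
    where
    e : ∀ a b → a ≡ b ℤ.+ (a ℤ.- b)
    e = ℤSolver.solve-∀
  base : disc 0 ≡ + 1
  base = trans (⊛-zero disc-root disc-root) (cong₂ ℤ._*_ disc-root-zero disc-root-zero)
  first : disc 1 ≡ -[1+ 3 ]
  first = trans (sym (ℤ.*-identityˡ (disc 1))) (trans (rec 0) (cong (λ z → + 4 ℤ.* (+ 0 ℤ.* z) ℤ.+ -[1+ 3 ] ℤ.* z) base))
  cancel : ∀ n z → + suc n ℤ.* z ≡ + 0 → z ≡ + 0
  cancel n z p = ℤ.*-cancelˡ-≡ (+ suc n) z (+ 0) (trans p (sym (ℤ.*-zeroʳ (+ suc n))))
  rest : ∀ n → disc (suc (suc n)) ≡ + 0
  rest zero = cancel 1 _ (trans (rec 1) (cong (λ z → + 4 ℤ.* (+ 1 ℤ.* z) ℤ.+ -[1+ 3 ] ℤ.* z) first))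
  rest (suc n) = cancel (suc (suc n)) _ (trans (rec (suc (suc n))) (trans (cong (λ z → + 4 ℤ.* (+ suc (suc n) ℤ.* z) ℤ.+ -[1+ 3 ] ℤ.* z) (rest n)) (cong (λ z → + 4 ℤ.* z ℤ.+ + 0) (ℤ.*-zeroʳ (+ suc (suc n))))))

-- The identity 4x(C - (1 + xC²)) = (1 - 4x) - y² has right-hand side zero. Division by 4x means
-- reading it one degree higher and cancelling 4.
Cat-equation : Cat ≈ 1PS ⊕ X ⊛ (Cat ⊛ Cat)
Cat-equation n = ℤ.i-j≡0⇒i≡j _ _ (ℤ.*-cancelˡ-≡ (+ 4) _ (+ 0) (trans (sym (trans (const-⊛ (+ 4) (X ⊛ v) (suc n)) (cong (+ 4 ℤ.*_) (X⊛-suc v n)))) (zero-4Xv (suc n))))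
  where
  v = Cat ⊖ (1PS ⊕ X ⊛ (Cat ⊛ Cat))
  open ≈-Reasoning
  zero-4Xv : const (+ 4) ⊛ (X ⊛ v) ≈ 0PS
  zero-4Xv = begin
    const (+ 4) ⊛ (X ⊛ v) ≈⟨ solve 2 (λ x c → let 𝟙 = con (+ 1); y = 𝟙 :- con (+ 2) :* (x :* c) in
                                con (+ 4) :* (x :* (c :- (𝟙 :+ x :* (c :* c)))) := (𝟙 :- con (+ 4) :* x) :- y :* y) PSR.refl X Cat ⟩
    1-4X ⊖ disc ≈⟨ ≈⇒diff≈0 (PSR.sym disc≈1-4X) ⟩
    0PS ∎

infixl 7 _⊛ℕ_
_⊛ℕ_ : (ℕ → ℕ) → (ℕ → ℕ) → ℕ → ℕ
(p ⊛ℕ q) n = sum (map (λ i → p i ℕ.* q (n ∸ i)) (upTo (suc n)))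

gf-⊛ℕ : ∀ p q → gf p ⊛ gf q ≈ gf (p ⊛ℕ q)
gf-⊛ℕ p q n = go (upTo (suc n))
  where
  go : ∀ is → foldr ℤ._+_ (+ 0) (map (λ i → + p i ℤ.* + q (n ∸ i)) is) ≡ + sum (map (λ i → p i ℕ.* q (n ∸ i)) is)
  go [] = refl
  go (i ∷ is) = cong₂ ℤ._+_ (sym (ℤ.pos-* (p i) (q (n ∸ i)))) (go is)

catalan-convolution : ∀ n → catalan (suc n) ≡ (catalan ⊛ℕ catalan) n
catalan-convolution n = ℤ.+-injective (trans (Cat-equation (suc n)) (trans (ℤ.+-identityˡ _) (trans (X⊛-suc (Cat ⊛ Cat) n) (gf-⊛ℕ catalan catalan n))))

-- Enumerations

unique-length : ∀ {A : Set} {xs ys : List A} → Unique xs → Unique ys →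
  (∀ {x} → x ∈ xs → x ∈ ys) → (∀ {x} → x ∈ ys → x ∈ xs) → length xs ≡ length ys
unique-length xs! ys! p q = ↭-length (∼bag⇒↭ (unique∧set⇒bag xs! ys! (mk⇔ p q)))

-- The content of `CardAv` for an arbitrary predicate, so that the given counts and the counts of
-- the auxiliary classes combine.
record Enumeration {A : Set} (P : A → Set) (m : ℕ) : Set where
  field
    elements : List A
    elements!   : Unique elements
    size     : length elements ≡ m
    sound    : ∀ {x} → x ∈ elements → P x
    complete : ∀ {x} → P x → x ∈ elements

open Enumeration

module _ {A : Set} where

  -- The source of the recurrence for the given sequence: its own enumeration is compared with one
  -- assembled from smaller sizes.
  enum-functional : ∀ {P : A → Set} {m n} → Enumeration P m → Enumeration P n → m ≡ n
  enum-functional e f = trans (sym (size e))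
    (trans (unique-length (elements! e) (elements! f) (λ x∈e → complete f (sound e x∈e)) (λ x∈f → complete e (sound f x∈f))) (size f))

  enum-resp : ∀ {P Q : A → Set} {m} → (∀ {x} → P x → Q x) → (∀ {x} → Q x → P x) →
    Enumeration P m → Enumeration Q m
  enum-resp P⇒Q Q⇒P e = record
    { elements = elements e ; elements! = elements! e ; size = size e
    ; sound = λ x∈e → P⇒Q (sound e x∈e) ; complete = λ q → complete e (Q⇒P q) }

  enum-∅ : ∀ {P : A → Set} → (∀ {x} → ¬ P x) → Enumeration P 0
  enum-∅ ¬P = record
    { elements = [] ; elements! = [] ; size = refl ; sound = λ () ; complete = λ p → ⊥-elim (¬P p) }

  enum-singleton : ∀ (x : A) → Enumeration (_≡ x) 1
  enum-singleton x = record
    { elements = x ∷ [] ; elements! = [] ∷ [] ; size = refl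
    ; sound = λ { (here eq) → eq } ; complete = here }

  enum-⊎ : ∀ {P Q : A → Set} {m n} → (∀ {x} → P x → ¬ Q x) →
    Enumeration P m → Enumeration Q n → Enumeration (λ x → P x ⊎ Q x) (m ℕ.+ n)
  enum-⊎ disjoint e f = record
    { elements = elements e ++ elements f
    ; elements! = Unique.++⁺ (elements! e) (elements! f) (λ { (x∈e , x∈f) → disjoint (sound e x∈e) (sound f x∈f) })
    ; size = trans (length-++ (elements e)) (cong₂ ℕ._+_ (size e) (size f))
    ; sound = λ x∈ → [ (λ x∈e → inj₁ (sound e x∈e)) , (λ x∈f → inj₂ (sound f x∈f)) ]′ (∈-++⁻ (elements e) x∈)
    ; complete = [ (λ p → ∈-++⁺ˡ (complete e p)) , (λ q → ∈-++⁺ʳ (elements e) (complete f q)) ]′ }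

  enum-∃ : ∀ {I : Set} {P : I → A → Set} {m : I → ℕ} {is : List I} → Unique is →
    (∀ {i} → i ∈ is → Enumeration (P i) (m i)) →
    (∀ {i j x} → i ∈ is → j ∈ is → P i x → P j x → i ≡ j) →
    Enumeration (λ x → ∃ λ i → i ∈ is × P i x) (sum (map m is))
  enum-∃ [] e disjoint = enum-∅ (λ { (_ , () , _) })
  enum-∃ {P = P} {is = i ∷ is} (i∉is ∷ is!) e disjoint = enum-resp
    (λ { (inj₁ p) → _ , here refl , p ; (inj₂ (j , j∈ , p)) → j , there j∈ , p })
    (λ { (_ , here refl , p) → inj₁ p ; (j , there j∈ , p) → inj₂ (j , j∈ , p) })
    (enum-⊎ (λ { p (j , j∈ , q) → All.lookup i∉is j∈ (disjoint (here refl) (there j∈) p q) })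
      (e (here refl))
      (enum-∃ is! (λ j∈ → e (there j∈)) (λ j∈ k∈ → disjoint (there j∈) (there k∈))))

unique-map : ∀ {A B : Set} {f : A → B} {xs} → (∀ {x y} → x ∈ xs → y ∈ xs → f x ≡ f y → x ≡ y) →
  Unique xs → Unique (map f xs)
unique-map inj [] = []
unique-map {f = f} {x ∷ xs} inj (x∉xs ∷ xs!) =
  All.tabulate (λ {y} y∈ fx≡y → let z , z∈ , y≡fz = ∈-map⁻ f y∈ in
    All.lookup x∉xs z∈ (inj (here refl) (there z∈) (trans fx≡y y≡fz)))
  ∷ unique-map (λ y∈ z∈ → inj (there y∈) (there z∈)) xs!

enum-image : ∀ {A B : Set} {P : A → Set} {m} (f : A → B) → (∀ {x y} → P x → P y → f x ≡ f y → x ≡ y) →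
  Enumeration P m → Enumeration (λ y → ∃ λ x → P x × y ≡ f x) m
enum-image f inj e = record
  { elements = map f (elements e)
  ; elements! = unique-map (λ x∈ y∈ → inj (sound e x∈) (sound e y∈)) (elements! e)
  ; size = trans (length-map f (elements e)) (size e)
  ; sound = λ y∈ → let x , x∈ , eq = ∈-map⁻ f y∈ in x , sound e x∈ , eq
  ; complete = λ { (x , p , refl) → ∈-map⁺ f (complete e p) } }

length-cartesianProduct : ∀ {A B : Set} (xs : List A) (ys : List B) →
  length (cartesianProduct xs ys) ≡ length xs ℕ.* length ys
length-cartesianProduct [] ys = refl
length-cartesianProduct (x ∷ xs) ys = trans (length-++ (map (x ,_) ys))
  (cong₂ ℕ._+_ (length-map (x ,_) ys) (length-cartesianProduct xs ys))

enum-× : ∀ {A B : Set} {P : A → Set} {Q : B → Set} {m n} → Enumeration P m → Enumeration Q n →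
  Enumeration (λ xy → P (proj₁ xy) × Q (proj₂ xy)) (m ℕ.* n)
enum-× e f = record
  { elements = cartesianProduct (elements e) (elements f)
  ; elements! = Unique.cartesianProduct⁺ (elements! e) (elements! f)
  ; size = trans (length-cartesianProduct (elements e) (elements f)) (cong₂ ℕ._*_ (size e) (size f))
  ; sound = λ xy∈ → let x∈ , y∈ = ∈-cartesianProduct⁻ (elements e) (elements f) xy∈ in sound e x∈ , sound f y∈
  ; complete = λ { (p , q) → ∈-cartesianProduct⁺ (complete e p) (complete f q) } }

Word : Set
Word = List ℕ

-- P and Q see both sizes, so that they can also fix the value ranges of the factors.
data Join (n : ℕ) (P Q : ℕ → ℕ → Word → Set) : Word → Set where
  join : ∀ {i j u v} → i ℕ.+ j ≡ n → P i j u → Q i j v → Join n P Q (u ++ v)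

-- Concatenation forgets where the cut was. `parse` recovers the first factor, and the second
-- follows by cancellation; `length-inj` recovers the index, so different sizes contribute disjoint
-- sets of words.
enum-Join : ∀ {P Q : ℕ → ℕ → Word → Set} {p q : ℕ → ℕ} n →
  (∀ i j → i ℕ.+ j ≡ n → Enumeration (P i j) (p i)) →
  (∀ i j → i ℕ.+ j ≡ n → Enumeration (Q i j) (q j)) →
  (∀ {i j i′ j′ u v u′ v′} → i ℕ.+ j ≡ n → i′ ℕ.+ j′ ≡ n →
    P i j u → Q i j v → P i′ j′ u′ → Q i′ j′ v′ → u ++ v ≡ u′ ++ v′ → u ≡ u′) →
  (∀ {i j i′ j′ u} → P i j u → P i′ j′ u → i ≡ i′) →
  Enumeration (Join n P Q) ((p ⊛ℕ q) n)
enum-Join {P} {Q} {p} {q} n eP eQ parse length-inj = enum-resp to from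
  (enum-∃ {P = R} (Unique.upTo⁺ (suc n)) enum-R disjoint)
  where
  R : ℕ → Word → Set
  R i w = ∃ λ (uv : Word × Word) → (P i (n ∸ i) (proj₁ uv) × Q i (n ∸ i) (proj₂ uv)) × w ≡ proj₁ uv ++ proj₂ uv
  sum≡ : ∀ {i} → i ∈ upTo (suc n) → i ℕ.+ (n ∸ i) ≡ n
  sum≡ i∈ = ℕ.m+[n∸m]≡n (ℕ.s≤s⁻¹ (∈-upTo⁻ i∈))
  enum-R : ∀ {i} → i ∈ upTo (suc n) → Enumeration (R i) (p i ℕ.* q (n ∸ i))
  enum-R {i} i∈ = enum-image (λ uv → proj₁ uv ++ proj₂ uv)
    (λ { {u , v} {u′ , v′} (pu , qv) (pu′ , qv′) eq → inj eq (parse (sum≡ i∈) (sum≡ i∈) pu qv pu′ qv′ eq) })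
    (enum-× (eP i (n ∸ i) (sum≡ i∈)) (eQ i (n ∸ i) (sum≡ i∈)))
    where
    inj : ∀ {u v u′ v′ : Word} → u ++ v ≡ u′ ++ v′ → u ≡ u′ → (u , v) ≡ (u′ , v′)
    inj {u} eq refl = cong (u ,_) (++-cancelˡ u _ _ eq)
  disjoint : ∀ {i j x} → i ∈ upTo (suc n) → j ∈ upTo (suc n) → R i x → R j x → i ≡ j
  disjoint i∈ j∈ (_ , (pu , qv) , eq) (_ , (pu′ , qv′) , eq′) =
    length-inj pu (subst (P _ _) (sym (parse (sum≡ i∈) (sum≡ j∈) pu qv pu′ qv′ (trans (sym eq) eq′))) pu′)
  to : ∀ {w} → (∃ λ i → i ∈ upTo (suc n) × R i w) → Join n P Q w
  to (i , i∈ , _ , (pu , qv) , refl) = join (sum≡ i∈) pu qv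
  from : ∀ {w} → Join n P Q w → ∃ λ i → i ∈ upTo (suc n) × R i w
  from (join {i} {j} {u} {v} refl pu qv) = i , ∈-upTo⁺ (s≤s (ℕ.m≤m+n i j)) , (u , v) ,
    subst (λ k → P i k u × Q i k v) (sym (ℕ.m+n∸m≡n i j)) (pu , qv) , refl

-- Words and patterns

infix 4 _≺_
_≺_ : Word → Word → Set
u ≺ v = ∀ {x y} → x ∈ u → y ∈ v → x < y

record Spans (b n : ℕ) (w : Word) : Set where
  field
    unique   : Unique w
    lower    : ∀ {x} → x ∈ w → b ≤ x
    upper    : ∀ {x} → x ∈ w → x < b + n
    covers   : ∀ {x} → b ≤ x → x < b + n → x ∈ w

open Spans

unique-++⁻ : ∀ (u : Word) {v} → Unique (u ++ v) → Unique u × Unique v × (∀ {x} → x ∈ u → x ∉ v)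
unique-++⁻ [] v! = [] , v! , λ ()
unique-++⁻ (x ∷ u) (x∉ ∷ uv!) = let u! , v! , disjoint = unique-++⁻ u uv! in
  All.++⁻ˡ u x∉ ∷ u! , v! , λ { (here refl) x∈v → All.lookup (All.++⁻ʳ u x∉) x∈v refl ; (there y∈u) → disjoint y∈u }

∈-++-comm : ∀ (u : Word) {v x} → x ∈ u ++ v → x ∈ v ++ u
∈-++-comm u {v} x∈ = [ ∈-++⁺ʳ v , ∈-++⁺ˡ ]′ (∈-++⁻ u x∈)

spans-length : ∀ {b n w} → Spans b n w → length w ≡ n
spans-length {b} {n} s = trans
  (unique-length (unique s) (Unique.applyUpTo⁺₁ (b ℕ.+_) n (λ i<j _ eq → ℕ.<⇒≢ i<j (ℕ.+-cancelˡ-≡ b _ _ eq)))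
    (λ x∈ → subst (_∈ applyUpTo (b ℕ.+_) n) (ℕ.m+[n∸m]≡n (lower s x∈))
       (∈-applyUpTo⁺ (b ℕ.+_) (ℕ.+-cancelˡ-< b _ _ (subst (_< b + n) (sym (ℕ.m+[n∸m]≡n (lower s x∈))) (upper s x∈)))))
    (λ x∈ → let i , i<n , eq = ∈-applyUpTo⁻ (b ℕ.+_) x∈ in
       subst (_∈ _) (sym eq) (covers s (ℕ.m≤m+n b i) (ℕ.+-monoʳ-< b i<n))))
  (length-applyUpTo (b ℕ.+_) n)

-- Spanning an interval does not depend on the order of the letters, so the skew versions of sum and
-- splitting follow from the direct ones by exchanging the factors.
spans-swap : ∀ {b n} u {v} → Spans b n (u ++ v) → Spans b n (v ++ u)
spans-swap u {v} s = let u! , v! , disjoint = unique-++⁻ u (unique s) in record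
  { unique = Unique.++⁺ v! u! (λ { (x∈v , x∈u) → disjoint x∈u x∈v })
  ; lower = lower s ∘ ∈-++-comm v
  ; upper = upper s ∘ ∈-++-comm v
  ; covers = λ b≤x x< → ∈-++-comm u (covers s b≤x x<) }

spans-sum : ∀ {b i j u v} → Spans b i u → Spans (b + i) j v → Spans b (i + j) (u ++ v)
spans-sum {b} {i} {j} {u} {v} su sv = record
  { unique = Unique.++⁺ (unique su) (unique sv) (λ { (x∈u , x∈v) → ℕ.<⇒≱ (upper su x∈u) (lower sv x∈v) })
  ; lower = [ lower su , (λ x∈v → ℕ.≤-trans (ℕ.m≤m+n b i) (lower sv x∈v)) ]′ ∘ ∈-++⁻ u
  ; upper = λ {x} → [ (λ x∈u → ℕ.<-≤-trans (upper su x∈u) (ℕ.+-monoʳ-≤ b (ℕ.m≤m+n i j)))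
                  , (λ x∈v → subst (x <_) (ℕ.+-assoc b i j) (upper sv x∈v)) ]′ ∘ ∈-++⁻ u
  ; covers = covers′ }
  where
  covers′ : ∀ {x} → b ≤ x → x < b + (i + j) → x ∈ u ++ v
  covers′ {x} b≤x x< with x ℕ.<? b + i
  ... | yes x<b+i = ∈-++⁺ˡ (covers su b≤x x<b+i)
  ... | no x≮b+i  = ∈-++⁺ʳ u (covers sv (ℕ.≮⇒≥ x≮b+i) (subst (x <_) (sym (ℕ.+-assoc b i j)) x<))

spans-skew : ∀ {b i j u v} → Spans (b + j) i u → Spans b j v → Spans b (i + j) (u ++ v)
spans-skew {b} {i} {j} {u} {v} su sv = subst (λ n → Spans b n (u ++ v)) (ℕ.+-comm j i) (spans-swap v (spans-sum sv su))

maximum : ∀ x (u : Word) → ∃ λ m → m ∈ x ∷ u × (∀ {y} → y ∈ x ∷ u → y ≤ m)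
maximum x [] = x , here refl , λ { (here refl) → ℕ.≤-refl }
maximum x (y ∷ u) with maximum y u
... | m , m∈ , m-max with ℕ.≤-total x m
... | inj₁ x≤m = m , there m∈ , λ { (here refl) → x≤m ; (there y∈) → m-max y∈ }
... | inj₂ m≤x = x , here refl , λ { (here refl) → ℕ.≤-refl ; (there y∈) → ℕ.≤-trans (m-max y∈) m≤x }

spans-[] : ∀ {b} → Spans b 0 []
spans-[] {b} = record
  { unique = [] ; lower = λ () ; upper = λ ()
  ; covers = λ {x} b≤x x< → ⊥-elim (ℕ.<⇒≱ (subst (x <_) (ℕ.+-identityʳ b) x<) b≤x) }

-- If m is the maximum of `u`, every value up to m must occur in `u`, so `u` spans b, ..., m and has
-- m + 1 - b letters. The empty `u` has no maximum and is treated apart.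
split-sum : ∀ {b n} u {v} → Spans b n (u ++ v) → u ≺ v →
  ∃₂ λ i j → i + j ≡ n × Spans b i u × Spans (b + i) j v
split-sum {b} {n} [] {v} s u≺v = 0 , n , refl , spans-[] , subst (λ c → Spans c n v) (sym (ℕ.+-identityʳ b)) s
split-sum {b} {n} u@(x ∷ u′) {v} s u≺v with maximum x u′
... | m , m∈u , m-max = i , n ∸ i , i+[n∸i]≡n , su , sv
  where
  i = suc m ∸ b
  b+i≡ : b + i ≡ suc m
  b+i≡ = ℕ.m+[n∸m]≡n (ℕ.m≤n⇒m≤1+n (lower s (∈-++⁺ˡ m∈u)))
  i+[n∸i]≡n : i + (n ∸ i) ≡ n
  i+[n∸i]≡n = ℕ.m+[n∸m]≡n (ℕ.+-cancelˡ-≤ b i n (subst (_≤ b + n) (sym b+i≡) (upper s (∈-++⁺ˡ m∈u))))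
  u!×v! = unique-++⁻ u (unique s)
  su : Spans b i u
  su = record
    { unique = proj₁ u!×v!
    ; lower = λ y∈u → lower s (∈-++⁺ˡ y∈u)
    ; upper = λ {y} y∈u → subst (y <_) (sym b+i≡) (s≤s (m-max y∈u))
    ; covers = λ {y} b≤y y< → let y≤m = ℕ.s≤s⁻¹ (subst (y <_) b+i≡ y<) in
        [ id , (λ y∈v → ⊥-elim (ℕ.<⇒≱ (u≺v m∈u y∈v) y≤m)) ]′
          (∈-++⁻ u (covers s b≤y (ℕ.≤-<-trans y≤m (upper s (∈-++⁺ˡ m∈u))))) }
  b+i+j≡ : b + i + (n ∸ i) ≡ b + n
  b+i+j≡ = trans (ℕ.+-assoc b i _) (cong (b ℕ.+_) i+[n∸i]≡n)
  sv : Spans (b + i) (n ∸ i) v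
  sv = record
    { unique = proj₁ (proj₂ u!×v!)
    ; lower = λ {y} y∈v → subst (_≤ y) (sym b+i≡) (u≺v m∈u y∈v)
    ; upper = λ {y} y∈v → subst (y <_) (sym b+i+j≡) (upper s (∈-++⁺ʳ u y∈v))
    ; covers = λ {y} ≤y y< →
        [ (λ y∈u → ⊥-elim (ℕ.<⇒≱ (subst (_≤ y) b+i≡ ≤y) (m-max y∈u))) , id ]′
          (∈-++⁻ u (covers s (ℕ.≤-trans (ℕ.m≤m+n b i) ≤y) (subst (y <_) b+i+j≡ y<))) }

split-skew : ∀ {b n} u {v} → Spans b n (u ++ v) → v ≺ u →
  ∃₂ λ i j → i + j ≡ n × Spans (b + j) i u × Spans b j v
split-skew u {v} s v≺u = let j , i , eq , sv , su = split-sum v (spans-swap u s) v≺u in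
  i , j , trans (ℕ.+-comm i j) eq , su , sv

skew-≺ : ∀ {b i j u v} → Spans (b + j) i u → Spans b j v → v ≺ u
skew-≺ su sv y∈v x∈u = ℕ.<-≤-trans (upper sv y∈v) (lower su x∈u)

sum-≺ : ∀ {b i j u v} → Spans b i u → Spans (b + i) j v → u ≺ v
sum-≺ su sv x∈u y∈v = ℕ.<-≤-trans (upper su x∈u) (lower sv y∈v)

spans-singleton : ∀ {b} → Spans b 1 (b ∷ [])
spans-singleton {b} = record
  { unique = [] ∷ []
  ; lower = λ { (here refl) → ℕ.≤-refl }
  ; upper = λ { (here refl) → subst (b <_) (ℕ.+-comm 1 b) ℕ.≤-refl }
  ; covers = λ {x} b≤x x< → here (ℕ.≤-antisym (ℕ.s≤s⁻¹ (subst (x <_) (ℕ.+-comm b 1) x<)) b≤x) }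

spans-singleton⁻ : ∀ {b n m} → Spans b n (m ∷ []) → n ≡ 1 × m ≡ b
spans-singleton⁻ {b} s with refl ← spans-length s with covers s ℕ.≤-refl (subst (b <_) (ℕ.+-comm 1 b) ℕ.≤-refl)
... | here eq = refl , sym eq

spans-top : ∀ {b n u} → Spans b n u → Spans b (suc n) (u ++ b + n ∷ [])
spans-top {b} {n} {u} s = subst (λ k → Spans b k (u ++ b + n ∷ [])) (ℕ.+-comm n 1) (spans-sum s spans-singleton)

split-at-max : ∀ {b n} u {M v} → Spans b n (u ++ M ∷ v) → u ≺ M ∷ [] → v ≺ u → v ≺ M ∷ [] →
  ∃₂ λ i j → suc (i + j) ≡ n × Spans (b + j) i u × M ≡ b + j + i × Spans b j v
split-at-max {b} {n} u {M} {v} s u≺M v≺u v≺M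
  with split-skew (u ++ M ∷ []) (subst (Spans b n) (sym (++-assoc u (M ∷ []) v)) s)
         (λ x∈v y∈ → [ v≺u x∈v , v≺M x∈v ]′ (∈-++⁻ u y∈))
... | _ , j , eq , suM , sv with split-sum u suM u≺M
... | i , k , refl , su , sM with spans-singleton⁻ sM
... | refl , M≡ = i , j , trans (cong (_+ j) (ℕ.+-comm 1 i)) eq , su , M≡ , sv

⊆-++⁻ : ∀ {s : Word} u {v} → s ⊆ u ++ v → ∃₂ λ s₁ s₂ → s ≡ s₁ ++ s₂ × s₁ ⊆ u × s₂ ⊆ v
⊆-++⁻ [] p = [] , _ , refl , [] , p
⊆-++⁻ (x ∷ u) (.x ∷ʳ p) = let s₁ , s₂ , eq , q , r = ⊆-++⁻ u p in s₁ , s₂ , eq , x ∷ʳ q , r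
⊆-++⁻ (x ∷ u) (refl ∷ p) = let s₁ , s₂ , eq , q , r = ⊆-++⁻ u p in x ∷ s₁ , s₂ , cong (x ∷_) eq , refl ∷ q , r

Av12 Av132 Av1243 Av2413 Av3142 AvT : Word → Set
Av12 w   = ∀ {a b} → a ∷ b ∷ [] ⊆ w → ¬ a < b
Av132 w  = ∀ {a b c} → a ∷ b ∷ c ∷ [] ⊆ w → a < c → ¬ c < b
Av1243 w = ∀ {a b c d} → a ∷ b ∷ c ∷ d ∷ [] ⊆ w → a < b → b < d → ¬ d < c
Av2413 w = ∀ {a b c d} → a ∷ b ∷ c ∷ d ∷ [] ⊆ w → c < a → a < d → ¬ d < b
Av3142 w = ∀ {a b c d} → a ∷ b ∷ c ∷ d ∷ [] ⊆ w → b < d → d < a → ¬ a < c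
AvT w    = Av1243 w × Av2413 w × Av3142 w

-- Direct sums and skew sums

pattern 0th = here refl
pattern 1st = there (here refl)
pattern 2nd = there (there (here refl))
pattern 3rd = there (there (there (here refl)))

av132-skew : ∀ {u v} → v ≺ u → Av132 u → Av132 v → Av132 (u ++ v)
av132-skew {u} v≺u au av p a<c c<b with ⊆-++⁻ u p
... | []                  , _  , refl , _ , r = av r a<c c<b
... | _ ∷ []              , _  , refl , q , r = ℕ.<-asym a<c (v≺u (lookup r 1st) (lookup q 0th))
... | _ ∷ _ ∷ []          , _  , refl , q , r = ℕ.<-asym a<c (v≺u (lookup r 0th) (lookup q 0th))
... | _ ∷ _ ∷ _ ∷ []      , [] , refl , q , _ = au q a<c c<b
... | _ ∷ _ ∷ _ ∷ _ ∷ _   , _  , ()   , _ , _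

-- No pattern is a skew sum: at each cut some letter before it is smaller than some letter after it.
-- For 1243 and 2413 the first and last letters serve at every cut; 3142 needs 3 < 4 at the first
-- two cuts and 1 < 2 at the third.
avT-skew : ∀ {u v} → v ≺ u → AvT u → AvT v → AvT (u ++ v)
avT-skew {u} {v} v≺u (u₁ , u₂ , u₃) (v₁ , v₂ , v₃) = w₁ , w₂ , w₃
  where
  w₁ : Av1243 (u ++ v)
  w₁ p a<b b<d d<c with ⊆-++⁻ u p
  ... | []                  , _  , refl , _ , r = v₁ r a<b b<d d<c
  ... | _ ∷ []              , _  , refl , q , r = ℕ.<-asym (ℕ.<-trans a<b b<d) (v≺u (lookup r 2nd) (lookup q 0th))
  ... | _ ∷ _ ∷ []          , _  , refl , q , r = ℕ.<-asym (ℕ.<-trans a<b b<d) (v≺u (lookup r 1st) (lookup q 0th))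
  ... | _ ∷ _ ∷ _ ∷ []      , _  , refl , q , r = ℕ.<-asym (ℕ.<-trans a<b b<d) (v≺u (lookup r 0th) (lookup q 0th))
  ... | _ ∷ _ ∷ _ ∷ _ ∷ []  , [] , refl , q , _ = u₁ q a<b b<d d<c
  ... | _ ∷ _ ∷ _ ∷ _ ∷ _ ∷ _ , _ , ()  , _ , _
  w₂ : Av2413 (u ++ v)
  w₂ p c<a a<d d<b with ⊆-++⁻ u p
  ... | []                  , _  , refl , _ , r = v₂ r c<a a<d d<b
  ... | _ ∷ []              , _  , refl , q , r = ℕ.<-asym a<d (v≺u (lookup r 2nd) (lookup q 0th))
  ... | _ ∷ _ ∷ []          , _  , refl , q , r = ℕ.<-asym a<d (v≺u (lookup r 1st) (lookup q 0th))
  ... | _ ∷ _ ∷ _ ∷ []      , _  , refl , q , r = ℕ.<-asym a<d (v≺u (lookup r 0th) (lookup q 0th))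
  ... | _ ∷ _ ∷ _ ∷ _ ∷ []  , [] , refl , q , _ = u₂ q c<a a<d d<b
  ... | _ ∷ _ ∷ _ ∷ _ ∷ _ ∷ _ , _ , ()  , _ , _
  w₃ : Av3142 (u ++ v)
  w₃ p b<d d<a a<c with ⊆-++⁻ u p
  ... | []                  , _  , refl , _ , r = v₃ r b<d d<a a<c
  ... | _ ∷ []              , _  , refl , q , r = ℕ.<-asym a<c (v≺u (lookup r 1st) (lookup q 0th))
  ... | _ ∷ _ ∷ []          , _  , refl , q , r = ℕ.<-asym a<c (v≺u (lookup r 0th) (lookup q 0th))
  ... | _ ∷ _ ∷ _ ∷ []      , _  , refl , q , r = ℕ.<-asym b<d (v≺u (lookup r 0th) (lookup q 1st))
  ... | _ ∷ _ ∷ _ ∷ _ ∷ []  , [] , refl , q , _ = u₃ q b<d d<a a<c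
  ... | _ ∷ _ ∷ _ ∷ _ ∷ _ ∷ _ , _ , ()  , _ , _

∈-singleton-irrefl : ∀ {M x y} → x ∈ M ∷ [] → y ∈ M ∷ [] → ¬ x < y
∈-singleton-irrefl 0th 0th = ℕ.<-irrefl refl

av132-top : ∀ {u M} → u ≺ M ∷ [] → Av132 u → Av132 (u ++ M ∷ [])
av132-top {u} u≺M au p a<c c<b with ⊆-++⁻ u p
... | []                  , _  , refl , _ , r = ∈-singleton-irrefl (lookup r 2nd) (lookup r 1st) c<b
... | _ ∷ []              , _  , refl , q , r = ∈-singleton-irrefl (lookup r 1st) (lookup r 0th) c<b
... | _ ∷ _ ∷ []          , _  , refl , q , r = ℕ.<-asym c<b (u≺M (lookup q 1st) (lookup r 0th))
... | _ ∷ _ ∷ _ ∷ []      , [] , refl , q , _ = au q a<c c<b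
... | _ ∷ _ ∷ _ ∷ _ ∷ _   , _  , ()   , _ , _

-- The final maximum could only be the last letter of an occurrence, and no pattern ends in its
-- largest letter.
avT-top : ∀ {u M} → u ≺ M ∷ [] → AvT u → AvT (u ++ M ∷ [])
avT-top {u} {M} u≺M (u₁ , u₂ , u₃) = w₁ , w₂ , w₃
  where
  w₁ : Av1243 (u ++ M ∷ [])
  w₁ p a<b b<d d<c with ⊆-++⁻ u p
  ... | []                  , _  , refl , _ , r = ∈-singleton-irrefl (lookup r 3rd) (lookup r 2nd) d<c
  ... | _ ∷ []              , _  , refl , q , r = ∈-singleton-irrefl (lookup r 2nd) (lookup r 1st) d<c
  ... | _ ∷ _ ∷ []          , _  , refl , q , r = ∈-singleton-irrefl (lookup r 1st) (lookup r 0th) d<c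
  ... | _ ∷ _ ∷ _ ∷ []      , _  , refl , q , r = ℕ.<-asym d<c (u≺M (lookup q 2nd) (lookup r 0th))
  ... | _ ∷ _ ∷ _ ∷ _ ∷ []  , [] , refl , q , _ = u₁ q a<b b<d d<c
  ... | _ ∷ _ ∷ _ ∷ _ ∷ _ ∷ _ , _ , ()  , _ , _
  w₂ : Av2413 (u ++ M ∷ [])
  w₂ p c<a a<d d<b with ⊆-++⁻ u p
  ... | []                  , _  , refl , _ , r = ∈-singleton-irrefl (lookup r 3rd) (lookup r 1st) d<b
  ... | _ ∷ []              , _  , refl , q , r = ∈-singleton-irrefl (lookup r 2nd) (lookup r 0th) d<b
  ... | _ ∷ _ ∷ []          , _  , refl , q , r = ℕ.<-asym d<b (u≺M (lookup q 1st) (lookup r 1st))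
  ... | _ ∷ _ ∷ _ ∷ []      , _  , refl , q , r = ℕ.<-asym d<b (u≺M (lookup q 1st) (lookup r 0th))
  ... | _ ∷ _ ∷ _ ∷ _ ∷ []  , [] , refl , q , _ = u₂ q c<a a<d d<b
  ... | _ ∷ _ ∷ _ ∷ _ ∷ _ ∷ _ , _ , ()  , _ , _
  w₃ : Av3142 (u ++ M ∷ [])
  w₃ p b<d d<a a<c with ⊆-++⁻ u p
  ... | []                  , _  , refl , _ , r = ∈-singleton-irrefl (lookup r 3rd) (lookup r 0th) d<a
  ... | _ ∷ []              , _  , refl , q , r = ℕ.<-asym d<a (u≺M (lookup q 0th) (lookup r 2nd))
  ... | _ ∷ _ ∷ []          , _  , refl , q , r = ℕ.<-asym d<a (u≺M (lookup q 0th) (lookup r 1st))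
  ... | _ ∷ _ ∷ _ ∷ []      , _  , refl , q , r = ℕ.<-asym d<a (u≺M (lookup q 0th) (lookup r 0th))
  ... | _ ∷ _ ∷ _ ∷ _ ∷ []  , [] , refl , q , _ = u₃ q b<d d<a a<c
  ... | _ ∷ _ ∷ _ ∷ _ ∷ _ ∷ _ , _ , ()  , _ , _

-- Each pattern contains 132, as 243 or as 142, so `v` alone holds none. A single letter of 1243 in
-- `u` still leaves a 132 in `v`. In all other cases the letters in `u` contain an ascent, or one of
-- them exceeds a letter in `v`.
avT-decreasing-sum : ∀ {u v} → u ≺ v → Av12 u → Av132 v → AvT (u ++ v)
avT-decreasing-sum {u} {v} u≺v au av = w₁ , w₂ , w₃
  where
  w₁ : Av1243 (u ++ v)
  w₁ p a<b b<d d<c with ⊆-++⁻ u p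
  ... | []                  , _  , refl , _ , r = av (∷ˡ⁻ r) b<d d<c
  ... | _ ∷ []              , _  , refl , _ , r = av r b<d d<c
  ... | _ ∷ _ ∷ []            , _  , refl , q , _ = au (⊆-trans (refl ∷ refl ∷ minimum _) q) a<b
  ... | _ ∷ _ ∷ _ ∷ []        , _  , refl , q , _ = au (⊆-trans (refl ∷ refl ∷ minimum _) q) a<b
  ... | _ ∷ _ ∷ _ ∷ _ ∷ []    , _  , refl , q , _ = au (⊆-trans (refl ∷ refl ∷ minimum _) q) a<b
  ... | _ ∷ _ ∷ _ ∷ _ ∷ _ ∷ _ , _ , ()  , _ , _
  w₂ : Av2413 (u ++ v)
  w₂ p c<a a<d d<b with ⊆-++⁻ u p
  ... | []                  , _  , refl , _ , r = av (⊆-trans (refl ∷ refl ∷ _ ∷ʳ refl ∷ []) r) a<d d<b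
  ... | _ ∷ []              , _  , refl , q , r = ℕ.<-asym c<a (u≺v (lookup q 0th) (lookup r 1st))
  ... | _ ∷ _ ∷ []            , _  , refl , q , _ = au (⊆-trans (refl ∷ refl ∷ minimum _) q) (ℕ.<-trans a<d d<b)
  ... | _ ∷ _ ∷ _ ∷ []        , _  , refl , q , _ = au (⊆-trans (refl ∷ refl ∷ minimum _) q) (ℕ.<-trans a<d d<b)
  ... | _ ∷ _ ∷ _ ∷ _ ∷ []    , _  , refl , q , _ = au (⊆-trans (refl ∷ refl ∷ minimum _) q) (ℕ.<-trans a<d d<b)
  ... | _ ∷ _ ∷ _ ∷ _ ∷ _ ∷ _ , _ , ()  , _ , _
  w₃ : Av3142 (u ++ v)
  w₃ p b<d d<a a<c with ⊆-++⁻ u p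
  ... | []                  , _  , refl , _ , r = av (∷ˡ⁻ r) b<d (ℕ.<-trans d<a a<c)
  ... | _ ∷ []              , _  , refl , q , r = ℕ.<-asym d<a (u≺v (lookup q 0th) (lookup r 2nd))
  ... | _ ∷ _ ∷ []          , _  , refl , q , r = ℕ.<-asym d<a (u≺v (lookup q 0th) (lookup r 1st))
  ... | _ ∷ _ ∷ _ ∷ []        , _  , refl , q , _ = au (⊆-trans (refl ∷ _ ∷ʳ refl ∷ minimum _) q) a<c
  ... | _ ∷ _ ∷ _ ∷ _ ∷ []    , _  , refl , q , _ = au (⊆-trans (refl ∷ _ ∷ʳ refl ∷ minimum _) q) a<c
  ... | _ ∷ _ ∷ _ ∷ _ ∷ _ ∷ _ , _ , ()  , _ , _

-- The classes of words in the decomposition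

B A : ℕ → ℕ → Word → Set
B b n w = Spans b n w × Av132 w
A b n w = Spans b n w × AvT w

Topped : (ℕ → ℕ → Word → Set) → ℕ → ℕ → Word → Set
Topped P b n w = ∃ λ u → P b n u × w ≡ u ++ b + n ∷ []

decreasing : ℕ → ℕ → Word
decreasing b zero    = []
decreasing b (suc n) = b + n ∷ decreasing b n

-- The words of H b n and J b n have length n + 1; J is the class of skew-indecomposable avoiders.
B⁺ N H J : ℕ → ℕ → Word → Set
B⁺ b zero    w = ⊥
B⁺ b (suc n) w = B b (suc n) w
N b zero    = λ _ → ⊥
N b (suc n) = Join n (λ i j → Topped B (b + j) i) (λ i j → B⁺ b j)
H b n       = Join n (λ i j → _≡ decreasing b (suc i)) (λ i j → N (b + suc i) j)
J b n w     = Topped A b n w ⊎ H b n w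

B⁺⇒B : ∀ {b n w} → B⁺ b n w → B b n w
B⁺⇒B {n = suc n} p = p

≺-top : ∀ {b n u} → Spans b n u → u ≺ b + n ∷ []
≺-top s x∈ 0th = upper s x∈

topped-B : ∀ {b n w} → Topped B b n w → B b (suc n) w
topped-B (u , (s , a) , refl) = spans-top s , av132-top (≺-top s) a

topped-A : ∀ {b n w} → Topped A b n w → A b (suc n) w
topped-A (u , (s , a) , refl) = spans-top s , avT-top (≺-top s) a

B-join : ∀ {b n w} → Join n (λ i j → Topped B (b + j) i) (λ i j → B b j) w → B b (suc n) w
B-join (join refl pu (sv , av)) = let su , au = topped-B pu in
  spans-skew su sv , av132-skew (skew-≺ su sv) au av

N⇒B : ∀ {b n w} → N b n w → B b n w
N⇒B {n = suc n} (join i+j≡n pu pv) = B-join (join i+j≡n pu (B⁺⇒B pv))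

spans-decreasing : ∀ b n → Spans b n (decreasing b n)
spans-decreasing b zero    = spans-[]
spans-decreasing b (suc n) = spans-skew spans-singleton (spans-decreasing b n)

av12-decreasing : ∀ b n → Av12 (decreasing b n)
av12-decreasing b (suc n) (_ ∷ʳ p) x<y = av12-decreasing b n p x<y
av12-decreasing b (suc n) (refl ∷ p) x<y = ℕ.<-asym x<y (upper (spans-decreasing b n) (to∈ p))

decreasing-unique : ∀ {b n w} → Spans b n w → Av12 w → w ≡ decreasing b n
decreasing-unique {w = []} s a with refl ← spans-length s = refl
decreasing-unique {b} {zero} {x ∷ w} s a with () ← spans-length s
decreasing-unique {b} {suc n} {x ∷ w} s a
  with split-skew (x ∷ []) s (λ { y∈ 0th → ℕ.≤∧≢⇒< (ℕ.≮⇒≥ (a (refl ∷ from∈ y∈))) (λ { refl → Unique.Unique[x∷xs]⇒x∉xs (unique s) y∈ }) })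
... | i , j , eq , sx , sw with spans-singleton⁻ sx
... | refl , refl with refl ← eq = cong (x ∷_) (decreasing-unique sw (λ p → a (_ ∷ʳ p)))

H⇒A : ∀ {b n w} → H b n w → A b (suc n) w
H⇒A {b} (join {i} {j} refl refl pv) = let su = spans-decreasing b (suc i) ; sv , av = N⇒B {n = j} pv in
  spans-sum su sv , avT-decreasing-sum (sum-≺ su sv) (av12-decreasing b (suc i)) av

J⇒A : ∀ {b n w} → J b n w → A b (suc n) w
J⇒A = [ topped-A , H⇒A ]′

A-join : ∀ {b n w} → Join n (λ i j → J (b + j) i) (λ i j → A b j) w → A b (suc n) w
A-join (join refl pu (sv , av)) = let su , au = J⇒A pu in
  spans-skew su sv , avT-skew (skew-≺ su sv) au av

-- Uniqueness of the skew decomposition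

SkewIndecomposable : Word → Set
SkewIndecomposable w = ∀ {s t} → w ≡ s ++ t → s ≢ [] → t ≢ [] → ¬ t ≺ s

last-∈ : ∀ s {t} w {y : ℕ} → w ++ y ∷ [] ≡ s ++ t → t ≢ [] → y ∈ t
last-∈ []      w       refl t≢[] = ∈-++⁺ʳ w 0th
last-∈ (x ∷ s) []      eq   t≢[] with s | ∷-injectiveʳ eq
... | [] | refl = ⊥-elim (t≢[] refl)
last-∈ (x ∷ s) (z ∷ w) eq   t≢[] = last-∈ s w (∷-injectiveʳ eq) t≢[]

-- A skew cut leaves the first letter on the left and the last on the right, so the last would be
-- smaller. This one test covers both alternatives of `J`.
first≤last⇒indecomposable : ∀ {w x w₁ w₂ y} → w ≡ x ∷ w₁ → w ≡ w₂ ++ y ∷ [] → x ≤ y → SkewIndecomposable w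
first≤last⇒indecomposable eq₁ eq₂ x≤y {[]} eq s≢[] t≢[] t≺s = s≢[] refl
first≤last⇒indecomposable {w₂ = w₂} eq₁ eq₂ x≤y {z ∷ s} eq s≢[] t≢[] t≺s
  with ∷-injectiveˡ (trans (sym eq) eq₁)
... | refl = ℕ.<⇒≱ (t≺s (last-∈ (z ∷ s) w₂ (trans (sym eq₂) eq) t≢[]) 0th) x≤y

topped-indecomposable : ∀ {u M} → u ≺ M ∷ [] → SkewIndecomposable (u ++ M ∷ [])
topped-indecomposable {[]}    u≺M = first≤last⇒indecomposable {w₂ = []} refl refl ℕ.≤-refl
topped-indecomposable {x ∷ u} u≺M = first≤last⇒indecomposable {w₂ = x ∷ u} refl refl (ℕ.<⇒≤ (u≺M 0th 0th))

sum-indecomposable : ∀ {x u v} → x ∷ u ≺ v → v ≢ [] → SkewIndecomposable (x ∷ u ++ v)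
sum-indecomposable {x} {u} {v} u≺v v≢[] with initLast v
... | []       = ⊥-elim (v≢[] refl)
... | v′ ∷ʳ′ y = first≤last⇒indecomposable {w₂ = x ∷ u ++ v′} refl (sym (++-assoc (x ∷ u) v′ (y ∷ [])))
                   (ℕ.<⇒≤ (u≺v 0th (∈-++⁺ʳ v′ 0th)))

spans-nonempty : ∀ {b n w} → Spans b (suc n) w → w ≢ []
spans-nonempty s refl with () ← spans-length s

N⇒nonempty : ∀ {b n w} → N b n w → w ≢ []
N⇒nonempty {n = suc n} p = spans-nonempty (proj₁ (N⇒B {n = suc n} p))

J⇒indecomposable : ∀ {b n w} → J b n w → SkewIndecomposable w
J⇒indecomposable (inj₁ (u , (s , _) , refl)) = topped-indecomposable (≺-top s)
J⇒indecomposable {b} (inj₂ (join {i} {j} refl refl pv)) =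
  sum-indecomposable (sum-≺ (spans-decreasing b (suc i)) (proj₁ (N⇒B {n = j} pv))) (N⇒nonempty {n = j} pv)

++-compare : ∀ (u u′ : Word) {v v′} → u ++ v ≡ u′ ++ v′ →
  (∃ λ t → u′ ≡ u ++ t × v ≡ t ++ v′) ⊎ (∃ λ t → u ≡ u′ ++ t × v′ ≡ t ++ v)
++-compare []      u′       eq = inj₁ (u′ , refl , eq)
++-compare (x ∷ u) []       eq = inj₂ (x ∷ u , refl , sym eq)
++-compare (x ∷ u) (y ∷ u′) eq with refl ← ∷-injectiveˡ eq with ++-compare u u′ (∷-injectiveʳ eq)
... | inj₁ (t , p , q) = inj₁ (t , cong (x ∷_) p , q)
... | inj₂ (t , p , q) = inj₂ (t , cong (x ∷_) p , q)

-- When two factorizations start with `u` and with a longer `u′`, the excess `t` begins `v` and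
-- hence lies below `u`. Then `u ++ t` would be a skew decomposition of `u′`.
skew-prefix : ∀ {u v u′ : Word} t {v′} → SkewIndecomposable u′ → u ≢ [] → v ≺ u → u′ ≡ u ++ t → v ≡ t ++ v′ → u ≡ u′
skew-prefix {u} []        ind u≢[] v≺u refl refl = sym (++-identityʳ u)
skew-prefix     t@(_ ∷ _) ind u≢[] v≺u eq   refl = ⊥-elim (ind eq u≢[] (λ ()) (λ x∈t y∈u → v≺u (∈-++⁺ˡ x∈t) y∈u))

skew-parse : ∀ {u v u′ v′} → SkewIndecomposable u → SkewIndecomposable u′ → u ≢ [] → u′ ≢ [] →
  v ≺ u → v′ ≺ u′ → u ++ v ≡ u′ ++ v′ → u ≡ u′
skew-parse {u} {u′ = u′} ind ind′ u≢[] u′≢[] v≺u v′≺u′ eq with ++-compare u u′ eq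
... | inj₁ (t , p , q) = skew-prefix t ind′ u≢[] v≺u p q
... | inj₂ (t , p , q) = sym (skew-prefix t ind u′≢[] v′≺u′ p q)

-- Decomposition and counting

av132-⊆ : ∀ {u w} → u ⊆ w → Av132 w → Av132 u
av132-⊆ u⊆w a p = a (⊆-trans p u⊆w)

avT-⊆ : ∀ {u w} → u ⊆ w → AvT w → AvT u
avT-⊆ u⊆w (a₁ , a₂ , a₃) = (λ p → a₁ (⊆-trans p u⊆w)) , (λ p → a₂ (⊆-trans p u⊆w)) , (λ p → a₃ (⊆-trans p u⊆w))

split-max : ∀ {b n w} → Spans b (suc n) w →
  ∃₂ λ u v → w ≡ u ++ b + n ∷ v × u ≺ b + n ∷ [] × v ≺ b + n ∷ []
split-max {b} {n} s with ∈-∃++ (covers s (ℕ.m≤m+n b n) (ℕ.+-monoʳ-< b (ℕ.n<1+n n)))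
... | u , v , refl with unique-++⁻ u (unique s)
... | _ , Mv! , disjoint = u , v , refl
  , (λ { x∈u 0th → below (∈-++⁺ˡ x∈u) (λ { refl → disjoint x∈u 0th }) })
  , (λ { x∈v 0th → below (∈-++⁺ʳ u (there x∈v)) (λ { refl → Unique.Unique[x∷xs]⇒x∉xs Mv! x∈v }) })
  where
  below : ∀ {x} → x ∈ u ++ b + n ∷ v → x ≢ b + n → x < b + n
  below {x} x∈ x≢ = ℕ.≤∧≢⇒< (ℕ.s≤s⁻¹ (subst (x <_) (ℕ.+-suc b n) (upper s x∈))) x≢

distinct : ∀ {b n} u {v x y} → Spans b n (u ++ v) → x ∈ u → y ∈ v → x ≢ y
distinct u s x∈u y∈v refl = proj₂ (proj₂ (unique-++⁻ u (unique s))) x∈u y∈v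

-- A letter x of `u` below a letter y of `v` would make x M y a 132, so the maximum separates large
-- letters from small ones.
split-B : ∀ {b n} u {M v} → Spans b n (u ++ M ∷ v) → u ≺ M ∷ [] → v ≺ M ∷ [] → Av132 (u ++ M ∷ v) →
  ∃₂ λ i j → suc (i + j) ≡ n × B (b + j) i u × M ≡ b + j + i × B b j v
split-B u {M} {v} s u≺M v≺M a with split-at-max u s u≺M v≺u v≺M
  where
  v≺u : v ≺ u
  v≺u y∈v x∈u = ℕ.≤∧≢⇒< (ℕ.≮⇒≥ (λ x<y → a (++⁺ (from∈ x∈u) (refl ∷ from∈ y∈v)) x<y (v≺M y∈v 0th)))
    (λ y≡x → distinct u s x∈u (there y∈v) (sym y≡x))
... | i , j , eq , su , M≡ , sv = i , j , eq , (su , av132-⊆ (++⁺ʳ (M ∷ v) ⊆-refl) a) , M≡ , (sv , av132-⊆ (++⁺ˡ u (M ∷ʳ ⊆-refl)) a)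

B-split : ∀ {b n w} → B b (suc n) w → Join n (λ i j → Topped B (b + j) i) (λ i j → B b j) w
B-split (s , a) with split-max s
... | u , v , refl , u≺M , v≺M with split-B u s u≺M v≺M a
... | i , j , refl , pu , M≡ , pv = subst (Join (i + j) _ _) (++-assoc u _ v)
  (join refl (u , pu , cong (λ m → u ++ m ∷ []) M≡) pv)

-- The cut is at the first failure of `P`. The hypothesis `closed` concerns two-letter sublists, the
-- form in which pattern avoidance supplies it.
span-by : ∀ {P : ℕ → Set} → (∀ x → Dec (P x)) → (w : Word) → (∀ {x y} → x ∷ y ∷ [] ⊆ w → P y → P x) →
  ∃₂ λ u v → w ≡ u ++ v × (∀ {x} → x ∈ u → P x) × (∀ {x} → x ∈ v → ¬ P x)
span-by P? [] closed = [] , [] , refl , (λ ()) , λ ()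
span-by P? (x ∷ w) closed with P? x
... | no ¬px = [] , x ∷ w , refl , (λ ()) , λ { 0th → ¬px ; (there y∈w) py → ¬px (closed (refl ∷ from∈ y∈w) py) }
... | yes px with span-by P? w (λ p → closed (x ∷ʳ p))
... | u , v , refl , pu , ¬pv = x ∷ u , v , refl , (λ { 0th → px ; (there y∈u) → pu y∈u }) , ¬pv

A-split-skew : ∀ {b n} u {M v} → Spans b (suc n) (u ++ M ∷ v) → u ≺ M ∷ [] → v ≺ M ∷ [] → v ≺ u → AvT (u ++ M ∷ v) →
  Join n (λ i j → J (b + j) i) (λ i j → A b j) (u ++ M ∷ v)
A-split-skew u {M} {v} s u≺M v≺M v≺u a with split-at-max u s u≺M v≺u v≺M
... | i , j , refl , su , refl , sv = subst (Join (i + j) _ _) (++-assoc u _ v)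
  (join refl (inj₁ (u , (su , avT-⊆ (++⁺ʳ (M ∷ v) ⊆-refl) a) , refl)) (sv , avT-⊆ (++⁺ˡ u (M ∷ʳ ⊆-refl)) a))

N-intro : ∀ {b n} u {M v r} → Spans b n (u ++ M ∷ v) → u ≺ M ∷ [] → v ≺ M ∷ [] → r ∈ v → Av132 (u ++ M ∷ v) → N b n (u ++ M ∷ v)
N-intro u {M} {v} s u≺M v≺M r∈v a with split-B u s u≺M v≺M a
... | i , zero , refl , pu , M≡ , (sv , _) with _ ∷ _ ← v with () ← spans-length sv
... | i , suc j , refl , pu , M≡ , pv = subst (Join (i + suc j) _ _) (++-assoc u _ v)
  (join refl (u , pu , cong (λ m → u ++ m ∷ []) M≡) pv)

-- If the first letter x is exceeded by a letter r after the maximum M, then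
-- comparison with x cuts w as (x ∷ d) e M f g with g < x ∷ d < e M f.
A-split-sum : ∀ {b n} x u {M v r} → Spans b (suc n) (x ∷ u ++ M ∷ v) → x ∷ u ≺ M ∷ [] → v ≺ M ∷ [] →
  r ∈ v → x < r → AvT (x ∷ u ++ M ∷ v) → Join n (λ i j → J (b + j) i) (λ i j → A b j) (x ∷ u ++ M ∷ v)
A-split-sum {b} {n} x u {M} {v} {r} s u≺M v≺M r∈v x<r a@(a₁ , a₂ , a₃)
  with span-by (ℕ._≤? x) u small-first | span-by (x ℕ.<?_) v big-first
  where
  -- Suppose y > x precedes z < x. If y < r, then x y M r is a 1243; if r < y, then y z M r is a
  -- 3142.
  small-first : ∀ {y z} → y ∷ z ∷ [] ⊆ u → z ≤ x → y ≤ x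
  small-first {y} {z} p z≤x = ℕ.≮⇒≥ λ x<y →
    let z∈u = lookup p 1st
        y∈u = lookup p 0th
        z<x = ℕ.≤∧≢⇒< z≤x (λ z≡x → Unique.Unique[x∷xs]⇒x∉xs (unique s) (subst (_∈ u ++ M ∷ v) z≡x (∈-++⁺ˡ z∈u)))
    in [ (λ y≤r → a₁ (refl ∷ ++⁺ (from∈ y∈u) (refl ∷ from∈ r∈v)) x<y
                     (ℕ.≤∧≢⇒< y≤r (distinct (x ∷ u) s (there y∈u) (there r∈v))) (v≺M r∈v 0th))
       , (λ r≤y → a₃ (x ∷ʳ ++⁺ p (refl ∷ from∈ r∈v)) (ℕ.<-trans z<x x<r)
                     (ℕ.≤∧≢⇒< r≤y (λ r≡y → distinct (x ∷ u) s (there y∈u) (there r∈v) (sym r≡y))) (u≺M (there y∈u) 0th)) ]′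
       (ℕ.≤-total y r)
  -- If y < x < z, then x M y z is a 2413.
  big-first : ∀ {y z} → y ∷ z ∷ [] ⊆ v → x < z → x < y
  big-first {y} {z} p x<z = ℕ.≤∧≢⇒<
    (ℕ.≮⇒≥ λ y<x → a₂ (refl ∷ ++⁺ˡ u (refl ∷ p)) y<x x<z (v≺M (lookup p 1st) 0th))
    (distinct (x ∷ u) s 0th (there (lookup p 0th)))
... | d , e , refl , d≤x , e≰x | f , g , refl , x<f , x≮g
  = subst (Join n _ _) (sym regroup) (assemble (split-skew (D ++ E) (subst (Spans b (suc n)) regroup s) g≺DE))
  where
  D E : Word
  D = x ∷ d
  E = e ++ M ∷ f
  regroup : x ∷ (d ++ e) ++ M ∷ f ++ g ≡ (D ++ E) ++ g
  regroup = trans (++-assoc D e (M ∷ f ++ g))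
    (trans (cong (D ++_) (sym (++-assoc e (M ∷ f) g))) (sym (++-assoc D E g)))
  D≤x : ∀ {y} → y ∈ D → y ≤ x
  D≤x 0th = ℕ.≤-refl
  D≤x (there y∈d) = d≤x y∈d
  x<E : ∀ {y} → y ∈ E → x < y
  x<E y∈ with ∈-++⁻ e y∈
  ... | inj₁ y∈e = ℕ.≰⇒> (e≰x y∈e)
  ... | inj₂ 0th = u≺M 0th 0th
  ... | inj₂ (there y∈f) = x<f y∈f
  r∈f : r ∈ f
  r∈f = [ id , (λ r∈g → ⊥-elim (x≮g r∈g x<r)) ]′ (∈-++⁻ f r∈v)
  D≺E : D ≺ E
  D≺E y∈D z∈E = ℕ.≤-<-trans (D≤x y∈D) (x<E z∈E)
  g<x : ∀ {y} → y ∈ g → y < x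
  g<x y∈g = ℕ.≤∧≢⇒< (ℕ.≮⇒≥ (x≮g y∈g)) (λ { refl → distinct (x ∷ d ++ e) s 0th (there (∈-++⁺ʳ f y∈g)) refl })
  g≺DE : g ≺ D ++ E
  g≺DE {y} {z} y∈g z∈ with ∈-++⁻ D z∈
  ... | inj₂ z∈E = ℕ.<-trans (g<x y∈g) (x<E z∈E)
  ... | inj₁ 0th = g<x y∈g
  ... | inj₁ (there z∈d) = ℕ.≤∧≢⇒<
    -- Here z < y < x, so x z M y would be a 3142.
    (ℕ.≮⇒≥ λ z<y → a₃ (refl ∷ ++⁺ (++⁺ʳ e (from∈ z∈d)) (refl ∷ ++⁺ˡ f (from∈ y∈g))) z<y (g<x y∈g) (u≺M 0th 0th))
    (λ { refl → distinct (x ∷ d ++ e) s (there (∈-++⁺ˡ z∈d)) (there (∈-++⁺ʳ f y∈g)) refl })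
  -- An ascent y z in `D` stays below r, so y z M r would be a 1243.
  av12-D : Av12 D
  av12-D p y<z = a₁ (++⁺ (++⁺ʳ e p) (refl ∷ from∈ (∈-++⁺ˡ {ys = g} r∈f))) y<z
    (ℕ.≤-<-trans (D≤x (lookup p 1st)) x<r) (v≺M r∈v 0th)
  -- The letter x in front of a 132 in `E` would complete a 1243.
  av132-E : Av132 E
  av132-E p y<t t<z = a₁ (⊆-trans (refl ∷ ++⁺ʳ g (++⁺ˡ d p)) (⊆-reflexive (sym regroup))) (x<E (lookup p 0th)) y<t t<z
  e≺M : e ≺ M ∷ []
  e≺M y∈e = u≺M (there (∈-++⁺ʳ d y∈e))
  f≺M : f ≺ M ∷ []
  f≺M y∈f = v≺M (∈-++⁺ˡ y∈f)
  assemble : (∃₂ λ i j → i + j ≡ suc n × Spans (b + j) i (D ++ E) × Spans b j g) →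
    Join n (λ i j → J (b + j) i) (λ i j → A b j) ((D ++ E) ++ g)
  assemble (i , j , i+j≡ , sDE , sg) with split-sum D sDE D≺E
  ... | zero , l , refl , sD , sE with () ← spans-length sD
  ... | suc k , l , refl , sD , sE = join (ℕ.suc-injective i+j≡)
    (inj₂ (join refl (decreasing-unique sD av12-D) (N-intro e sE e≺M f≺M r∈f av132-E)))
    (sg , avT-⊆ (⊆-trans (++⁺ˡ (D ++ E) ⊆-refl) (⊆-reflexive (sym regroup))) a)

-- Comparing `v` with the first letter x decides the case. If all of `v` is below x, it is below all
-- of x ∷ u: for z in `u` and y in `v` with z < y, the word x z M y would be a 3142.
A-split : ∀ {b n w} → A b (suc n) w → Join n (λ i j → J (b + j) i) (λ i j → A b j) w
A-split {b} {n} (s , a) with split-max s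
... | [] , v , refl , u≺M , v≺M = A-split-skew [] s u≺M v≺M (λ _ ()) a
... | x ∷ u , v , refl , u≺M , v≺M with any? (x ℕ.<?_) v
... | yes some = let r , r∈v , x<r = find some in A-split-sum x u s u≺M v≺M r∈v x<r a
... | no none = A-split-skew (x ∷ u) s u≺M v≺M v≺u a
  where
  v<x : ∀ {y} → y ∈ v → y < x
  v<x y∈v = ℕ.≤∧≢⇒< (ℕ.≮⇒≥ (none ∘ lose y∈v)) (λ y≡x → distinct (x ∷ u) s 0th (there y∈v) (sym y≡x))
  v≺u : v ≺ x ∷ u
  v≺u y∈v 0th = v<x y∈v
  v≺u y∈v (there z∈u) = ℕ.≤∧≢⇒<
    (ℕ.≮⇒≥ λ z<y → proj₂ (proj₂ a) (refl ∷ ++⁺ (from∈ z∈u) (refl ∷ from∈ y∈v)) z<y (v<x y∈v) (u≺M 0th 0th))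
    (λ y≡z → distinct (x ∷ u) s (there z∈u) (there y∈v) (sym y≡z))

-- The enumerations are required only for sizes up to `n`, so that the lemma can be applied inside
-- the strong induction of `enum-B`. They are required at every base, because the first factor
-- starts at `b + j`.
enum-skew : ∀ {P Q : ℕ → ℕ → Word → Set} {p q : ℕ → ℕ} n b →
  (∀ {c i w} → P c i w → Spans c (suc i) w × SkewIndecomposable w) →
  (∀ {c j w} → Q c j w → Spans c j w) →
  (∀ i → i ≤ n → ∀ c → Enumeration (P c i) (p i)) → (∀ j → j ≤ n → ∀ c → Enumeration (Q c j) (q j)) →
  Enumeration (Join n (λ i j → P (b + j) i) (λ i j → Q b j)) ((p ⊛ℕ q) n)
enum-skew {p = p} {q} n b P⇒ Q⇒ eP eQ = enum-Join {p = p} {q} n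
  (λ { i j refl → eP i (ℕ.m≤m+n i j) (b + j) })
  (λ { i j refl → eQ j (ℕ.m≤n+m j i) b })
  (λ _ _ pu qv pu′ qv′ → let su , iu = P⇒ pu ; su′ , iu′ = P⇒ pu′ in
    skew-parse iu iu′ (spans-nonempty su) (spans-nonempty su′) (skew-≺ su (Q⇒ qv)) (skew-≺ su′ (Q⇒ qv′)))
  (λ pu pu′ → ℕ.suc-injective (trans (sym (spans-length (proj₁ (P⇒ pu)))) (spans-length (proj₁ (P⇒ pu′)))))

enum-Topped : ∀ {P b n m} → Enumeration (P b n) m → Enumeration (Topped P b n) m
enum-Topped {b = b} {n} = enum-image (λ u → u ++ b + n ∷ []) (λ {u} {v} _ _ → ∷ʳ-injectiveˡ u v)

topped-B⇒ : ∀ {b n w} → Topped B b n w → Spans b (suc n) w × SkewIndecomposable w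
topped-B⇒ p@(u , (s , _) , refl) = proj₁ (topped-B p) , topped-indecomposable (≺-top s)

enum-B : ∀ n b → Enumeration (B b n) (catalan n)
enum-B = <-rec (λ n → ∀ b → Enumeration (B b n) (catalan n)) step
  where
  step : ∀ n → (∀ {m} → m < n → ∀ b → Enumeration (B b m) (catalan m)) → ∀ b → Enumeration (B b n) (catalan n)
  step zero    ih b = enum-resp (λ { refl → spans-[] , λ () }) (empty ∘ proj₁) (enum-singleton [])
    where
    empty : ∀ {w} → Spans b 0 w → w ≡ []
    empty {[]}    s = refl
    empty {_ ∷ _} s with () ← spans-length s
  step (suc n) ih b = subst (Enumeration (B b (suc n))) (sym (catalan-convolution n))
    (enum-resp B-join B-split (enum-skew n b topped-B⇒ proj₁ (λ i i≤n c → enum-Topped {B} (ih (s≤s i≤n) c)) (λ j j≤n → ih (s≤s j≤n))))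

catalan⁺ : ℕ → ℕ
catalan⁺ zero    = 0
catalan⁺ (suc n) = catalan (suc n)

-- The series are xC(C - 1) and xC(C - 1)/(1 - x). The decreasing factor has i + 1 letters, but `H`
-- is also indexed by one less than the length, so no further x appears.
N-count H-count : ℕ → ℕ
N-count zero    = 0
N-count (suc n) = (catalan ⊛ℕ catalan⁺) n
H-count = (λ _ → 1) ⊛ℕ N-count

enum-B⁺ : ∀ n b → Enumeration (B⁺ b n) (catalan⁺ n)
enum-B⁺ zero    b = enum-∅ id
enum-B⁺ (suc n) b = enum-B (suc n) b

enum-N : ∀ n b → Enumeration (N b n) (N-count n)
enum-N zero    b = enum-∅ id
enum-N (suc n) b = enum-skew n b topped-B⇒ (proj₁ ∘ B⁺⇒B) (λ i _ c → enum-Topped {B} (enum-B i c)) (λ j _ → enum-B⁺ j)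

enum-H : ∀ n b → Enumeration (H b n) (H-count n)
enum-H n b = enum-Join {p = λ _ → 1} {N-count} n (λ i _ _ → enum-singleton (decreasing b (suc i))) (λ i j _ → enum-N j (b + suc i))
  (λ { {i} {_} {i′} _ _ refl _ refl _ eq → cong (decreasing b ∘ suc) (first-injective {i} {i′} eq) })
  (λ { {i} {_} {i′} refl eq → first-injective {i} {i′} (cong (_++ []) eq) })
  where
  -- The first letter of `decreasing b (suc i)` is `b + i`, so it reveals `i`.
  first-injective : ∀ {i i′ v v′} → decreasing b (suc i) ++ v ≡ decreasing b (suc i′) ++ v′ → i ≡ i′
  first-injective eq = ℕ.+-cancelˡ-≡ b _ _ (∷-injectiveˡ eq)

B⁺-nonempty : ∀ {b n w} → B⁺ b n w → w ≢ []
B⁺-nonempty {n = suc n} (s , _) = spans-nonempty s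

-- A topped word ends in its maximum. The last letter of a word of `H` belongs to the nonempty part
-- after M, which lies below the part ending in M.
topped#H : ∀ {b n w} → Topped A b n w → ¬ H b n w
topped#H p (join {j = suc _} refl refl (join {u = []} refl pu pv)) = spans-nonempty (proj₁ (topped-B pu)) refl
topped#H {b} (t , _ , eq) p@(join {i} {suc j} refl refl (join {u = y ∷ u} {v} refl pu pv)) =
  ℕ.<⇒≱ (skew-≺ (proj₁ (topped-B pu)) (proj₁ (B⁺⇒B pv)) last∈v 0th)
    (ℕ.s≤s⁻¹ (subst (y <_) (ℕ.+-suc b (i + suc j)) (upper (proj₁ (H⇒A p)) (∈-++⁺ʳ (decreasing b (suc i)) 0th))))
  where
  last∈v : b + (i + suc j) ∈ v
  last∈v = last-∈ (decreasing b (suc i) ++ y ∷ u) t (trans (sym eq) (sym (++-assoc (decreasing b (suc i)) (y ∷ u) v))) (B⁺-nonempty pv)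

module _ {a : ℕ → ℕ} (enum-A : ∀ n b → Enumeration (A b n) (a n)) where

  enum-J : ∀ n b → Enumeration (J b n) (a n + H-count n)
  enum-J n b = enum-⊎ topped#H (enum-Topped {A} (enum-A n b)) (enum-H n b)

  A-count-zero : a 0 ≡ 1
  A-count-zero = enum-functional (enum-A 0 0) (enum-resp
    (λ { refl → spans-[] , (λ ()) , (λ ()) , (λ ()) }) (λ { {w} (s , _) → empty w s }) (enum-singleton []))
    where
    empty : ∀ w → Spans 0 0 w → w ≡ []
    empty []      s = refl
    empty (_ ∷ _) s with () ← spans-length s

  A-count-suc : ∀ n → a (suc n) ≡ ((λ i → a i + H-count i) ⊛ℕ a) n
  A-count-suc n = enum-functional (enum-A (suc n) 0) (enum-resp A-join A-split
    (enum-skew n 0 (λ p → proj₁ (J⇒A p) , J⇒indecomposable p) proj₁ (λ i _ → enum-J i) (λ j _ → enum-A j)))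

-- Vectors as words

word : ∀ {n} → ℕ → Vec (Fin n) n → Word
word b v = tabulate (λ i → b + toℕ (Vec.lookup v i))

tabulate-injective : ∀ {n} {f g : Fin n → ℕ} → tabulate f ≡ tabulate g → ∀ i → f i ≡ g i
tabulate-injective eq zero    = ∷-injectiveˡ eq
tabulate-injective eq (suc i) = tabulate-injective (∷-injectiveʳ eq) i

word-injective : ∀ {n} b {v v′ : Vec (Fin n) n} → word b v ≡ word b v′ → v ≡ v′
word-injective b {v} {v′} eq = trans (sym (Vec.tabulate∘lookup v)) (trans
  (Vec.tabulate-cong (λ i → Fin.toℕ-injective (ℕ.+-cancelˡ-≡ b _ _ (tabulate-injective eq i))))
  (Vec.tabulate∘lookup v′))

unique-tabulate⁻ : ∀ {n} {f : Fin n → ℕ} → Unique (tabulate f) → ∀ i j → f i ≡ f j → i ≡ j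
unique-tabulate⁻ f!            zero    zero    eq = refl
unique-tabulate⁻ (f0∉ ∷ f!)    zero    (suc j) eq = ⊥-elim (All.lookup f0∉ (∈-tabulate⁺ j) eq)
unique-tabulate⁻ (f0∉ ∷ f!)    (suc i) zero    eq = ⊥-elim (All.lookup f0∉ (∈-tabulate⁺ i) (sym eq))
unique-tabulate⁻ (f0∉ ∷ f!)    (suc i) (suc j) eq = cong suc (unique-tabulate⁻ f! i j eq)

-- Pigeonhole: a missed value, adjoined as a new image, would give an injection from n + 1 elements
-- into n.
injective⇒surjective : ∀ {n} {f : Fin n → Fin n} → (∀ i j → f i ≡ f j → i ≡ j) → ∀ y → ∃ λ i → f i ≡ y
injective⇒surjective {n} {f} f-inj y with Fin.any? (λ i → f i Fin.≟ y)
... | yes found = found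
... | no missed = ⊥-elim (ℕ.<-irrefl refl (Fin.injective⇒≤ {f = g} (λ {i} {j} → g-inj i j)))
  where
  g : Fin (suc n) → Fin n
  g zero    = y
  g (suc i) = f i
  g-inj : ∀ i j → g i ≡ g j → i ≡ j
  g-inj zero    zero    eq = refl
  g-inj zero    (suc j) eq = ⊥-elim (missed (j , sym eq))
  g-inj (suc i) zero    eq = ⊥-elim (missed (i , eq))
  g-inj (suc i) (suc j) eq = cong suc (f-inj i j eq)

isPerm⇒spans : ∀ {n} b (v : Vec (Fin n) n) → IsPerm n v → Spans b n (word b v)
isPerm⇒spans {n} b v perm = record
  { unique = Unique.tabulate⁺ (λ {i} {j} eq → perm i j (Fin.toℕ-injective (ℕ.+-cancelˡ-≡ b _ _ eq)))
  ; lower = λ x∈ → let i , eq = ∈-tabulate⁻ x∈ in subst (b ≤_) (sym eq) (ℕ.m≤m+n b _)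
  ; upper = λ x∈ → let i , eq = ∈-tabulate⁻ x∈ in subst (_< b + n) (sym eq) (ℕ.+-monoʳ-< b (Fin.toℕ<n (Vec.lookup v i)))
  ; covers = λ {x} b≤x x< →
      let x∸b<n = ℕ.+-cancelˡ-< b _ _ (subst (_< b + n) (sym (ℕ.m+[n∸m]≡n b≤x)) x<)
          i , eq = injective⇒surjective {f = Vec.lookup v} perm (fromℕ< x∸b<n)
      in subst (_∈ word b v) (trans (cong (λ y → b + toℕ y) eq) (trans (cong (b ℕ.+_) (Fin.toℕ-fromℕ< x∸b<n)) (ℕ.m+[n∸m]≡n b≤x)))
           (∈-tabulate⁺ i) }

spans⇒isPerm : ∀ {n} b (v : Vec (Fin n) n) → Spans b n (word b v) → IsPerm n v
spans⇒isPerm b v s i j eq = unique-tabulate⁻ (unique s) i j (cong (λ y → b + toℕ y) eq)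

word-surjective : ∀ {b n w} → Spans b n w → ∃ λ (v : Vec (Fin n) n) → w ≡ word b v
word-surjective {b} {n} {w} s with refl ← spans-length s = v , trans (sym (tabulate-lookup w)) (tabulate-cong entry)
  where
  bound : ∀ i → List.lookup w i ∸ b < length w
  bound i = ℕ.+-cancelˡ-< b _ _ (subst (_< b + length w) (sym (ℕ.m+[n∸m]≡n (lower s (∈-lookup i)))) (upper s (∈-lookup i)))
  v : Vec (Fin (length w)) (length w)
  v = Vec.tabulate (λ i → fromℕ< (bound i))
  entry : ∀ i → List.lookup w i ≡ b + toℕ (Vec.lookup v i)
  entry i = sym (trans (cong (λ y → b + toℕ y) (Vec.lookup∘tabulate (λ i → fromℕ< (bound i)) i))
    (trans (cong (b ℕ.+_) (Fin.toℕ-fromℕ< (bound i))) (ℕ.m+[n∸m]≡n (lower s (∈-lookup i)))))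

-- Pattern occurrences as sublists

Increasing : ∀ {k n} → (Fin k → Fin n) → Set
Increasing f = ∀ i j → toℕ i < toℕ j → toℕ (f i) < toℕ (f j)

sublist⇒positions : ∀ {k n} {s : Fin k → ℕ} {h : Fin n → ℕ} → tabulate s ⊆ tabulate h →
  Σ (Fin k → Fin n) λ f → Increasing f × (∀ i → s i ≡ h (f i))
sublist⇒positions {zero} p = (λ ()) , (λ ()) , λ ()
sublist⇒positions {suc k} {suc n} (_ ∷ʳ p) with sublist⇒positions {suc k} {n} p
... | f , f-inc , eq = suc ∘ f , (λ i j i<j → s<s (f-inc i j i<j)) , eq
sublist⇒positions {suc k} {suc n} {s} {h} (s0≡h0 ∷ p) with sublist⇒positions {k} {n} p
... | f , f-inc , eq = g , g-inc , g-eq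
  where
  g : Fin (suc k) → Fin (suc n)
  g zero    = zero
  g (suc i) = suc (f i)
  g-inc : Increasing g
  g-inc zero    (suc j) _         = s≤s z≤n
  g-inc (suc i) (suc j) (s≤s i<j) = s<s (f-inc i j i<j)
  g-eq : ∀ i → s i ≡ h (g i)
  g-eq zero    = s0≡h0
  g-eq (suc i) = eq i

predecessors : ∀ {k n} (f : Fin k → Fin (suc n)) → (∀ i → 0 < toℕ (f i)) → ∃ λ (g : Fin k → Fin n) → ∀ i → f i ≡ suc (g i)
predecessors f pos = (λ i → proj₁ (pred i)) , (λ i → proj₂ (pred i))
  where
  pred : ∀ i → ∃ λ j → f i ≡ suc j
  pred i with f i | pos i
  ... | suc j | _ = j , refl

-- Induction on `n`: if position 0 is not the first one chosen, monotonicity makes all chosen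
-- positions positive, and they can be shifted down by one.
positions⇒sublist : ∀ {k n} (f : Fin k → Fin n) (h : Fin n → ℕ) → Increasing f → tabulate (h ∘ f) ⊆ tabulate h
positions⇒sublist {zero} f h f-inc = minimum _
positions⇒sublist {suc k} {zero} f h f-inc with () ← f zero
positions⇒sublist {suc k} {suc n} f h f-inc with f zero in f0≡
... | zero = refl ∷ subst (_⊆ tabulate (h ∘ suc)) (tabulate-cong (λ i → cong h (sym (f≡ i))))
               (positions⇒sublist g (h ∘ suc) (λ i j i<j → ℕ.s<s⁻¹ (subst₂ (λ x y → toℕ x < toℕ y) (f≡ i) (f≡ j) (f-inc (suc i) (suc j) (s<s i<j)))))
  where
  gs = predecessors (f ∘ suc) (λ i → ℕ.≤-<-trans z≤n (f-inc zero (suc i) (s≤s z≤n)))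
  g = proj₁ gs
  f≡ = proj₂ gs
... | suc m = h zero ∷ʳ subst (_⊆ tabulate (h ∘ suc)) (cong₂ _∷_ (cong h (trans (sym (f≡ zero)) f0≡)) (tabulate-cong (λ i → cong h (sym (f≡ (suc i))))))
               (positions⇒sublist g (h ∘ suc) (λ i j i<j → ℕ.s<s⁻¹ (subst₂ (λ x y → toℕ x < toℕ y) (f≡ i) (f≡ j) (f-inc i j i<j))))
  where
  positive : ∀ i → 0 < toℕ (f i)
  positive zero    = subst (λ y → 0 < toℕ y) (sym f0≡) (s≤s z≤n)
  positive (suc i) = ℕ.≤-<-trans z≤n (f-inc zero (suc i) (s≤s z≤n))
  gs = predecessors f positive
  g = proj₁ gs
  f≡ = proj₂ gs

-- The values of rank 1, 2, 3, 4 of a pattern occurrence; other arguments are junk.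
chain : ℕ → ℕ → ℕ → ℕ → ℕ → ℕ
chain p q r s 0 = 0
chain p q r s 1 = p
chain p q r s 2 = q
chain p q r s 3 = r
chain p q r s (suc (suc (suc (suc _)))) = s

chain-mono : ∀ {p q r s} → p < q → q < r → r < s → ∀ {i j} → 1 ≤ i → j ≤ 4 → i < j → chain p q r s i < chain p q r s j
chain-mono p<q q<r r<s {1} {2} _ _ _ = p<q
chain-mono p<q q<r r<s {1} {3} _ _ _ = ℕ.<-trans p<q q<r
chain-mono p<q q<r r<s {1} {4} _ _ _ = ℕ.<-trans p<q (ℕ.<-trans q<r r<s)
chain-mono p<q q<r r<s {2} {3} _ _ _ = q<r
chain-mono p<q q<r r<s {2} {4} _ _ _ = ℕ.<-trans q<r r<s
chain-mono p<q q<r r<s {3} {4} _ _ _ = r<s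
chain-mono p<q q<r r<s {_} {1} (s≤s _) _ (s≤s ())
chain-mono p<q q<r r<s {suc (suc i)} {2} _ _ (s≤s (s≤s ()))
chain-mono p<q q<r r<s {suc (suc (suc i))} {3} _ _ (s≤s (s≤s (s≤s ())))
chain-mono p<q q<r r<s {suc (suc (suc (suc i)))} {4} _ _ (s≤s (s≤s (s≤s (s≤s ()))))
chain-mono p<q q<r r<s {_} {suc (suc (suc (suc (suc _))))} _ (s≤s (s≤s (s≤s (s≤s ())))) _

bounded? : (τ : Vec ℕ 4) → Dec (∀ i → 1 ≤ Vec.lookup τ i × Vec.lookup τ i ≤ 4)
bounded? τ = Fin.all? (λ i → (1 ℕ.≤? Vec.lookup τ i) ×-dec (Vec.lookup τ i ℕ.≤? 4))

-- For a concrete `τ` the tabulated list computes to the four letters in pattern order, so one lemma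
-- serves all three patterns. Only monotonicity of `chain` is needed; the converse comparison
-- follows by trichotomy.
contains⁺ : ∀ {n} b (v : Vec (Fin n) n) τ {τ-bounded : True (bounded? τ)} {p q r s} → p < q → q < r → r < s →
  tabulate (λ i → chain p q r s (Vec.lookup τ i)) ⊆ word b v → Contains v τ
contains⁺ b v τ {τ-bounded} {p} {q} {r} {s} p<q q<r r<s sub with sublist⇒positions sub
... | f , f-inc , eq = f , f-inc , λ i j → mk⇔ (to i j) (from i j)
  where
  τ< = toWitness τ-bounded
  mono : ∀ i j → Vec.lookup τ i < Vec.lookup τ j → chain p q r s (Vec.lookup τ i) < chain p q r s (Vec.lookup τ j)
  mono i j = chain-mono p<q q<r r<s (proj₁ (τ< i)) (proj₂ (τ< j))
  to : ∀ i j → Vec.lookup τ i < Vec.lookup τ j → toℕ (Vec.lookup v (f i)) < toℕ (Vec.lookup v (f j))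
  to i j τi<τj = ℕ.+-cancelˡ-< b _ _ (subst₂ _<_ (eq i) (eq j) (mono i j τi<τj))
  from : ∀ i j → toℕ (Vec.lookup v (f i)) < toℕ (Vec.lookup v (f j)) → Vec.lookup τ i < Vec.lookup τ j
  from i j vi<vj with ℕ.<-cmp (Vec.lookup τ i) (Vec.lookup τ j)
  ... | tri< τi<τj _ _ = τi<τj
  ... | tri≈ _ τi≡τj _ = ⊥-elim (ℕ.<-irrefl
          (ℕ.+-cancelˡ-≡ b _ _ (trans (sym (eq i)) (trans (cong (chain p q r s) τi≡τj) (eq j)))) vi<vj)
  ... | tri> _ _ τj<τi = ⊥-elim (ℕ.<-asym vi<vj (to j i τj<τi))

1243ᵖ 2413ᵖ 3142ᵖ : Vec ℕ 4
1243ᵖ = 1 Vec.∷ 2 Vec.∷ 4 Vec.∷ 3 Vec.∷ Vec.[]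
2413ᵖ = 2 Vec.∷ 4 Vec.∷ 1 Vec.∷ 3 Vec.∷ Vec.[]
3142ᵖ = 3 Vec.∷ 1 Vec.∷ 4 Vec.∷ 2 Vec.∷ Vec.[]

avoids⇒avT : ∀ {n} b (v : Vec (Fin n) n) → AvoidsAll v T → AvT (word b v)
avoids⇒avT b v (n₁ ∷ n₂ ∷ n₃ ∷ []) =
    (λ p a<b b<d d<c → n₁ (contains⁺ b v 1243ᵖ a<b b<d d<c p))
  , (λ p c<a a<d d<b → n₂ (contains⁺ b v 2413ᵖ c<a a<d d<b p))
  , (λ p b<d d<a a<c → n₃ (contains⁺ b v 3142ᵖ b<d d<a a<c p))

avT⇒avoids : ∀ {n} b (v : Vec (Fin n) n) → AvT (word b v) → AvoidsAll v T
avT⇒avoids b v (a₁ , a₂ , a₃) =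
    (λ { (f , f-inc , iso) → a₁ (sub f f-inc) (lt 1243ᵖ iso 0F 1F) (lt 1243ᵖ iso 1F 3F) (lt 1243ᵖ iso 3F 2F) })
  ∷ (λ { (f , f-inc , iso) → a₂ (sub f f-inc) (lt 2413ᵖ iso 2F 0F) (lt 2413ᵖ iso 0F 3F) (lt 2413ᵖ iso 3F 1F) })
  ∷ (λ { (f , f-inc , iso) → a₃ (sub f f-inc) (lt 3142ᵖ iso 1F 3F) (lt 3142ᵖ iso 3F 0F) (lt 3142ᵖ iso 0F 2F) })
  ∷ []
  where
  sub : ∀ f → Increasing f → tabulate {n = 4} (λ i → b + toℕ (Vec.lookup v (f i))) ⊆ word b v
  sub f f-inc = positions⇒sublist f _ f-inc
  lt : ∀ (τ : Vec ℕ 4) {f : Fin 4 → _} →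
    (∀ i j → (Vec.lookup τ i < Vec.lookup τ j) ⇔ (toℕ (Vec.lookup v (f i)) < toℕ (Vec.lookup v (f j)))) →
    ∀ i j → {True (Vec.lookup τ i ℕ.<? Vec.lookup τ j)} → b + toℕ (Vec.lookup v (f i)) < b + toℕ (Vec.lookup v (f j))
  lt τ iso i j {τi<τj} = ℕ.+-monoʳ-< b (Equivalence.to (iso i j) (toWitness τi<τj))

-- One list of permutations serves every base: `word b` adds `b` to each letter.
CardAv⇒enum-A : ∀ {n m} → CardAv T n m → ∀ b → Enumeration (A b n) m
CardAv⇒enum-A {n} {m} (L , L! , length≡ , L⇔) b = enum-resp
  (λ { (v , (perm , av) , refl) → isPerm⇒spans b v perm , avoids⇒avT b v av })
  (λ { (s , a) → from s a })
  (enum-image (word b) (λ _ _ → word-injective b) avoiders)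
  where
  avoiders : Enumeration (λ v → IsPerm n v × AvoidsAll v T) m
  avoiders = record
    { elements = L ; elements! = L! ; size = length≡
    ; sound = λ {v} → Equivalence.to (L⇔ v) ; complete = λ {v} → Equivalence.from (L⇔ v) }
  from : ∀ {w} → Spans b n w → AvT w → ∃ λ (v : Vec (Fin n) n) → (IsPerm n v × AvoidsAll v T) × w ≡ word b v
  from s a with word-surjective s
  ... | v , refl = v , (spans⇒isPerm b v s , avT⇒avoids b v a) , refl

-- The generating function

≈1+X⊛ : ∀ {f g} → f 0 ≡ + 1 → (∀ n → f (suc n) ≡ g n) → f ≈ 1PS ⊕ X ⊛ g
≈1+X⊛ {f} {g} f0 fs zero    = trans f0 (sym (cong (λ z → + 1 ℤ.+ z) (X⊛-zero g)))
≈1+X⊛ {f} {g} f0 fs (suc n) = trans (fs n) (sym (trans (ℤ.+-identityˡ _) (X⊛-suc g n)))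

N-gf : gf N-count ≈ X ⊛ (Cat ⊛ (Cat ⊖ 1PS))
N-gf zero    = sym (X⊛-zero (Cat ⊛ (Cat ⊖ 1PS)))
N-gf (suc n) = sym (trans (X⊛-suc (Cat ⊛ (Cat ⊖ 1PS)) n)
  (trans (⊛-cong {Cat} {g = Cat ⊖ 1PS} (λ _ → refl) Cat-1 n) (gf-⊛ℕ catalan catalan⁺ n)))
  where
  Cat-1 : Cat ⊖ 1PS ≈ gf catalan⁺
  Cat-1 zero    = refl
  Cat-1 (suc n) = ℤ.+-identityʳ (Cat (suc n))

avoider-equation : ∀ {a} → (∀ n → CardAv T n (a n)) →
  gf a ≈ (1PS ⊖ X) ⊛ (1PS ⊕ X ⊛ Cat ⊛ gf a ⊕ X ⊛ gf a ⊛ gf a)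
avoider-equation {a} card = functional-equation {Cat} {gf a} {gf j} {gf H-count} {gf N-count} {gf (λ _ → 1)}
  (≈1+X⊛ (cong +_ (A-count-zero enum-A)) (λ n → trans (cong +_ (A-count-suc enum-A n)) (sym (gf-⊛ℕ j a n))))
  (λ _ → refl)
  (λ n → sym (gf-⊛ℕ (λ _ → 1) N-count n))
  (≈1+X⊛ refl (λ _ → refl))
  N-gf
  Cat-equation
  where
  j : ℕ → ℕ
  j n = a n ℕ.+ H-count n
  enum-A : ∀ n b → Enumeration (A b n) (a n)
  enum-A n = CardAv⇒enum-A (card n)

theorem3p34 : (a : ℕ → ℕ) → (∀ n → CardAv T n (a n)) →
    Σ PS λ S →
    (S 0 ≡ + 1) ×
    (S ⊛ S ≈ poly (+ 1 ∷ -[1+ 4 ] ∷ + 10 ∷ -[1+ 4 ] ∷ []) ⊖ X ⊛ (poly (+ 1 ∷ []) ⊖ X) ⊛ (poly (+ 1 ∷ []) ⊕ X) ⊛ Cat) ×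
    (poly (+ 2 ∷ []) ⊛ X ⊛ (poly (+ 1 ∷ []) ⊖ X) ⊛ gf a ≈ (poly (+ 1 ∷ []) ⊖ X ⊛ (poly (+ 1 ∷ []) ⊖ X) ⊛ Cat) ⊖ S)
theorem3p34 a card = S , S0≡1 , discriminant Cat-equation (avoider-equation card) , λ n → a≡b-[b-a] (P n) (Q n)
  where
  P Q S : PS
  P = const (+ 2) ⊛ X ⊛ (1PS ⊖ X) ⊛ gf a
  Q = 1PS ⊖ X ⊛ (1PS ⊖ X) ⊛ Cat
  -- The root is defined by the claimed formula, which leaves its square to be checked; the constant
  -- term 1 selects the branch.
  S = Q ⊖ P
  S0≡1 : S 0 ≡ + 1
  S0≡1 = cong (λ z → + 1 ℤ.- z) (trans (⊛-zero (const (+ 2) ⊛ X ⊛ (1PS ⊖ X)) (gf a)) (ℤ.*-zeroˡ (+ a 0)))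
  a≡b-[b-a] : ∀ p q → p ≡ q ℤ.- (q ℤ.- p)
  a≡b-[b-a] = ℤSolver.solve-∀
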